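{- Let $G$ be a finite simple undirected graph with vertex set $[n]=\{1,\ldots,n\}$, and let $\chi_G$ be its chromatic polynomial. For any non-negative integers $i,j$, the number $(-1)^{n-i}\chi_G^{(i)}(-j)$ (where $\chi_G^{(i)}$ is the $i$-th derivative of $\chi_G$) equals the number of tuples $((V_1,\gamma_1),\ldots,(V_{i+j},\gamma_{i+j}))$ such that (1) $V_1,\ldots,V_{i+j}$ are pairwise disjoint subsets of $[n]$ with $\bigcup_k V_k=[n]$; (2) for every $k\in[i+j]$, $\gamma_k$ is an acyclic orientation of the induced subgraph $G[V_k]$; (3) for every $k\in[i]$, $V_k\neq\emptyset$ and $\gamma_k$ has a unique source, which is the vertex $\min(V_k)$.
   Context: $[0]=\emptyset$. The chromatic polynomial $\chi_G$ is the polynomial such that for each positive integer $q$, $\chi_G(q)$ is the number of proper colorings of $G$ with colors in $[q]$. $G[U]$ denotes the subgraph induced by $U$ (vertex set $U$, edges of $G$ with both endpoints in $U$). An orientation is acyclic if it has no directed cycle; a source is a vertex with no ingoing edge. -}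

module Defs where

open import Data.Nat using (ℕ; zero; suc; _<_; _≤_)
open import Data.Integer as ℤ using (ℤ; +_; -_)
open import Data.Bool using (Bool; true; false)
open import Data.Fin as Fin using (Fin; toℕ; inject₁; fromℕ)
open import Data.Fin.Subset using (Subset; _∈_)
open import Data.Vec using (Vec; lookup)
open import Data.List using (List; []; _∷_)
open import Data.Product using (Σ; ∃; _×_; _,_)
open import Data.Sum using (_⊎_)
open import Data.Refinement using (Refinement)
open import Relation.Binary.PropositionalEquality using (_≡_; _≢_)
open import Relation.Nullary using (¬_)
open import Function.Bundles using (_↔_; _⇔_)
open import Function.Definitions using (Injective)

-- Finite simple undirected graphs on the vertex set [n] = Fin n
-- (vertex k of Fin n stands for k+1 of [n]; the order is the same).

record Graph (n : ℕ) : Set where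
  field
    adj    : Fin n → Fin n → Bool
    sym    : ∀ u v → adj u v ≡ adj v u
    irrefl : ∀ u → adj u u ≡ false
open Graph public

Edge : ∀ {n} → Graph n → Fin n → Fin n → Set
Edge G u v = adj G u v ≡ true

HasCard : Set → ℕ → Set
HasCard X m = Fin m ↔ X

-- Proper colourings with colours in [q] (as vectors of colours, so
-- that equality of colourings is first-order).

Proper : ∀ {n} → Graph n → {q : ℕ} → Vec (Fin q) n → Set
Proper G c = ∀ u v → Edge G u v → lookup c u ≢ lookup c v

ProperColoring : ∀ {n} → Graph n → ℕ → Set
ProperColoring {n} G q = Refinement (Vec (Fin q) n) (Proper G)

Poly : Set
Poly = List ℤ

eval : Poly → ℤ → ℤ
eval []       x = + 0
eval (a ∷ as) x = a ℤ.+ x ℤ.* eval as x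

derivAux : ℕ → Poly → Poly
derivAux k []       = []
derivAux k (a ∷ as) = (+ k) ℤ.* a ∷ derivAux (suc k) as

deriv : Poly → Poly
deriv []       = []
deriv (_ ∷ as) = derivAux 1 as

derivⁱ : ℕ → Poly → Poly
derivⁱ zero    p = p
derivⁱ (suc i) p = deriv (derivⁱ i p)

IsChromaticPolynomial : ∀ {n} → Graph n → Poly → Set
IsChromaticPolynomial G p =
  ∀ (q : ℕ) → 1 ≤ q →
    Σ ℕ λ m → HasCard (ProperColoring G q) m × eval p (+ q) ≡ + m

-- Orientations.  An orientation is given by its arc set, encoded as a
-- Boolean matrix M: M[u][v] = true iff the arc u → v is present.

Orient : ℕ → Set
Orient n = Vec (Vec Bool n) n

Arc : ∀ {n} → Orient n → Fin n → Fin n → Set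
Arc M u v = lookup (lookup M u) v ≡ true

IsOrientationOf : ∀ {n} → Graph n → Subset n → Orient n → Set
IsOrientationOf G V M =
  (∀ u v → Arc M u v → u ∈ V × v ∈ V × Edge G u v) ×
  (∀ u v → u ∈ V → v ∈ V → Edge G u v →
     (Arc M u v × ¬ Arc M v u) ⊎ (Arc M v u × ¬ Arc M u v))

DirectedCycle : ∀ {n} → Orient n → Set
DirectedCycle {n} M =
  Σ ℕ λ m → Σ (Fin (suc (suc m)) → Fin n) λ v →
    Injective _≡_ _≡_ v ×
    (∀ (k : Fin (suc m)) → Arc M (v (inject₁ k)) (v (Fin.suc k))) ×
    Arc M (v (fromℕ (suc m))) (v Fin.zero)

Acyclic : ∀ {n} → Orient n → Set
Acyclic M = ¬ DirectedCycle M

IsSource : ∀ {n} → Subset n → Orient n → Fin n → Set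
IsSource V M s = s ∈ V × (∀ u → ¬ Arc M u s)

IsMin : ∀ {n} → Subset n → Fin n → Set
IsMin V s = s ∈ V × (∀ u → u ∈ V → s Fin.≤ u)

-- The tuples ((V₁,γ₁),…,(V_{i+j},γ_{i+j})) of the theorem
-- (indices shifted to 0,…,i+j-1).

RawTuple : ℕ → ℕ → Set
RawTuple n l = Vec (Subset n × Orient n) l

blk : ∀ {n l} → RawTuple n l → Fin l → Subset n
blk t k = Data.Product.proj₁ (lookup t k)

ori : ∀ {n l} → RawTuple n l → Fin l → Orient n
ori t k = Data.Product.proj₂ (lookup t k)

ValidTuple : ∀ {n} → Graph n → (i j : ℕ) → RawTuple n (i Data.Nat.+ j) → Set
ValidTuple {n} G i j t =
  (∀ k l → k ≢ l → ∀ v → ¬ (v ∈ blk t k × v ∈ blk t l)) ×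
  (∀ v → ∃ λ k → v ∈ blk t k) ×
  (∀ k → IsOrientationOf G (blk t k) (ori t k) × Acyclic (ori t k)) ×
  (∀ k → toℕ k < i →
     (∃ λ v → v ∈ blk t k) ×
     (∀ s → IsSource (blk t k) (ori t k) s ⇔ IsMin (blk t k) s))

Tuples : ∀ {n} → Graph n → ℕ → ℕ → Set
Tuples {n} G i j = Refinement (RawTuple n (i Data.Nat.+ j)) (ValidTuple G i j)

{-# OPTIONS --safe #-}
-- Functions on subsets of [n] are multiplied by (f ⋆ g)(V) = Σ_{W ⊆ V} f(W) g(V ∖ W).
-- Let I be the indicator of independent sets, a(V) the number of acyclic
-- orientations of G[V], b(V) the number of those whose unique source is min V,
-- A(V) = (-1)^|V| a(V) and L(V) = (-1)^(|V|-1) b(V). Summing (-1)^|W| over the sets W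
-- of sources of an acyclic orientation gives
--   I ⋆ A = δ,   L(V) = - Σ_{W ⊆ V ∖ min V} I(W) A(V ∖ W)   (V ≠ ∅),
-- and these two identities alone force I = exp(L) and A = exp(-L). Since
-- χ(q) = I^q for q ≥ 1, it follows that χ(x) = exp(xL), hence
-- χ^(i)(-j) = L^i ⋆ A^j, which counts the tuples up to sign.

module Submission where

open import Defs
open import Data.Bool using (Bool; true; false; if_then_else_)
import Data.Bool.Properties as Bool
open import Data.Empty as Empty using (⊥-elim)
open import Data.Fin as Fin using (Fin; zero; suc; toℕ; inject₁; inject≤; fromℕ)
import Data.Fin.Properties as Fin
open import Data.Fin.Permutation using (↔⇒≡)
open import Data.Fin.Subset using (Subset; _∈_; _⊆_; _─_; _∩_; Nonempty; ⊤; ⊥) renaming (∣_∣ to ∣_∣ₛ)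
open import Data.Fin.Subset.Properties
  using ( _∈?_; _⊆?_; nonempty?; Empty-unique; ∈⊤; ∉⊥; ∣⊤∣≡n; drop-∷-⊆; out⊆; in⊆in
        ; x∈p∩q⁺; x∈p∩q⁻; x∈p∧x∉q⇒x∈p─q; p─q⊆p; ∣p─q∣≤∣p∣)
open import Data.Integer using (ℤ; +_; -_; _*_; _^_; _+_; _-_; 0ℤ; 1ℤ; -1ℤ; ∣_∣)
import Data.Integer.Properties as ℤ
open import Data.Integer.Tactic.RingSolver using (solve-∀)
open import Data.Irrelevant using ([_])
open import Data.List as List using (List; []; _∷_; length; filter; cartesianProductWith; allFin)
import Data.List.Properties as List
import Data.List.Membership.Propositional as Membership
import Data.List.Membership.Propositional.Properties as Membership
open import Data.List.Relation.Unary.All as All using (All; []; _∷_)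
open import Data.List.Relation.Unary.AllPairs using ([]; _∷_)
open import Data.List.Relation.Unary.Any as Any using (here; there)
open import Data.List.Relation.Unary.Any.Properties using (lookup-index)
open import Data.List.Relation.Unary.Unique.Propositional using (Unique)
import Data.List.Relation.Unary.Unique.Propositional.Properties as Unique
open import Data.Nat as ℕ using (ℕ; zero; suc; _∸_)
import Data.Nat.Properties as ℕ
open import Data.Product using (Σ; ∃; _×_; _,_; proj₁; proj₂)
open import Data.Refinement using (Refinement; _,_; value-injective)
open import Data.Sum as Sum using (_⊎_; inj₁; inj₂)
import Data.Unit as Unit
open import Data.Vec as Vec using (Vec; []; _∷_; here; there; lookup)
import Data.Vec.Functional as Fun
import Data.Vec.Properties as Vec
open import Function using (_∘_; _⇔_; Equivalence; mk⇔; _↔_; mk↔ₛ′; id)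
open import Function.Construct.Composition using (_↔-∘_)
open import Function.Construct.Symmetry using (↔-sym)
open import Function.Definitions using (Injective)
open import Relation.Binary.PropositionalEquality as ≡
  using (_≡_; _≢_; _≗_; refl; cong; cong₂; trans; subst; module ≡-Reasoning)
open import Relation.Nullary using (¬_; Dec; yes; no; contradiction; does; recompute)
open import Relation.Nullary.Decidable as Dec using (_×-dec_; _⊎-dec_; _→-dec_; ¬?; dec-true)
open import Relation.Unary using (Decidable)

-- Source sets enter for this reason: an acyclic orientation of `G[V]` in which all vertices of W
-- are sources amounts to an independent W and an acyclic orientation of the rest, because every
-- edge at W is forced to leave W. So the signed sum over W becomes, for each acyclic orientation,
-- an alternating sum over the subsets of its source set, which is zero unless there is nothing to
-- choose from. A nonempty acyclic orientation has a source: with every W allowed nothing survives,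
-- and with min V barred from W exactly the orientations rooted at min V survive. The exponential is
-- a recursion on the first vertex, so no factorials occur and all values stay in ℤ; min V is the
-- first vertex present, which is why the second identity fits this recursion. Two obstacles remain.
-- The chromatic polynomial is known only through its values at positive integers, whereas
-- derivatives are formal operations on coefficient lists that are not unique. And the exponent
-- `n ∸ i` is truncated, so for i > n the count has to be shown to vanish.

private variable
  A B C : Set
  n : ℕ

-- Polynomials as coefficient lists and their formal derivatives

infixl 6 _⊞_
_⊞_ : Poly → Poly → Poly
[]      ⊞ q       = q
(a ∷ p) ⊞ []      = a ∷ p
(a ∷ p) ⊞ (b ∷ q) = a + b ∷ p ⊞ q

infixl 7 _⊡_
_⊡_ : ℤ → Poly → Poly
c ⊡ p = List.map (c *_) p

eval-⊞ : ∀ p q x → eval (p ⊞ q) x ≡ eval p x + eval q x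
eval-⊞ []      q       x = ≡.sym (ℤ.+-identityˡ _)
eval-⊞ (a ∷ p) []      x = ≡.sym (ℤ.+-identityʳ _)
eval-⊞ (a ∷ p) (b ∷ q) x = trans (cong (λ z → a + b + x * z) (eval-⊞ p q x)) (rearrange a b x (eval p x) (eval q x))
  where
  rearrange : ∀ a b x r s → a + b + x * (r + s) ≡ (a + x * r) + (b + x * s)
  rearrange = solve-∀

eval-⊡ : ∀ c p x → eval (c ⊡ p) x ≡ c * eval p x
eval-⊡ c []      x = ≡.sym (ℤ.*-zeroʳ c)
eval-⊡ c (a ∷ p) x = trans (cong (λ z → c * a + x * z) (eval-⊡ c p x)) (rearrange c a x (eval p x))
  where
  rearrange : ∀ c a x r → c * a + x * (c * r) ≡ c * (a + x * r)
  rearrange = solve-∀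

derivAux-⊞ : ∀ k p q → derivAux k (p ⊞ q) ≡ derivAux k p ⊞ derivAux k q
derivAux-⊞ k []      q       = refl
derivAux-⊞ k (a ∷ p) []      = refl
derivAux-⊞ k (a ∷ p) (b ∷ q) = cong₂ _∷_ (ℤ.*-distribˡ-+ (+ k) a b) (derivAux-⊞ (suc k) p q)

deriv-⊞ : ∀ p q → deriv (p ⊞ q) ≡ deriv p ⊞ deriv q
deriv-⊞ []      q       = refl
deriv-⊞ (a ∷ p) []      = ⊞-identityʳ (derivAux 1 p)
  where
  ⊞-identityʳ : ∀ p → p ≡ p ⊞ []
  ⊞-identityʳ []      = refl
  ⊞-identityʳ (a ∷ p) = refl
deriv-⊞ (a ∷ p) (b ∷ q) = derivAux-⊞ 1 p q

derivAux-⊡ : ∀ k c p → derivAux k (c ⊡ p) ≡ c ⊡ derivAux k p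
derivAux-⊡ k c []      = refl
derivAux-⊡ k c (a ∷ p) = cong₂ _∷_ (swap (+ k) c a) (derivAux-⊡ (suc k) c p)
  where
  swap : ∀ k c a → k * (c * a) ≡ c * (k * a)
  swap = solve-∀

deriv-⊡ : ∀ c p → deriv (c ⊡ p) ≡ c ⊡ deriv p
deriv-⊡ c []      = refl
deriv-⊡ c (a ∷ p) = derivAux-⊡ 1 c p

-- Raising the counter by one adds one more copy of every coefficient. This turns the positional
-- definition of `deriv` into the rule (a + x p)′ = p + x p′ of `eval-deriv-∷`.
eval-derivAux-suc : ∀ k p x → eval (derivAux (suc k) p) x ≡ eval p x + eval (derivAux k p) x
eval-derivAux-suc k []      x = refl
eval-derivAux-suc k (a ∷ p) x =
  trans (cong (λ z → + suc k * a + x * z) (eval-derivAux-suc (suc k) p x))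
        (rearrange (+ k) a x (eval p x) (eval (derivAux (suc k) p) x))
  where
  rearrange : ∀ k a x r s → (1ℤ + k) * a + x * (r + s) ≡ (a + x * r) + (k * a + x * s)
  rearrange = solve-∀

eval-deriv-∷ : ∀ a p x → eval (deriv (a ∷ p)) x ≡ eval p x + x * eval (deriv p) x
eval-deriv-∷ a p x = trans (eval-derivAux-suc 0 p x) (cong (λ z → eval p x + z) (derivAux-zero p))
  where
  derivAux-zero : ∀ p → eval (derivAux 0 p) x ≡ x * eval (deriv p) x
  derivAux-zero []      = ≡.sym (ℤ.*-zeroʳ x)
  derivAux-zero (b ∷ p) = ℤ.+-identityˡ _

-- Lists may carry trailing zeros, so polynomials with equal values need not be equal lists;
-- vanishing of all coefficients is the form of the conclusion that survives `deriv`. Once the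
-- constant term is gone a factor `+ q` is cancelled, and q ≥ 1 makes it nonzero.
vanishing⇒zero : ∀ p → (∀ q → 1 ℕ.≤ q → eval p (+ q) ≡ 0ℤ) → All (_≡ 0ℤ) p
vanishing⇒zero []      _ = []
vanishing⇒zero (a ∷ p) h = a≡0 ∷ vanishing⇒zero p p-vanishes
  where
  -- Every q ≥ 1 divides the constant term a; take q > ∣a∣.
  a≡0 : a ≡ 0ℤ
  a≡0 with eval p (+ suc ∣ a ∣) in eq | h (suc ∣ a ∣) (ℕ.s≤s ℕ.z≤n)
  ... | e | vanish with ∣ e ∣ in ∣e∣ | ∣a∣≡
    where
    ∣a∣≡ : ∣ a ∣ ≡ suc ∣ a ∣ ℕ.* ∣ e ∣
    ∣a∣≡ = trans (cong ∣_∣ (isolate a (+ suc ∣ a ∣ * e) vanish))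
             (trans (ℤ.∣-i∣≡∣i∣ (+ suc ∣ a ∣ * e)) (ℤ.abs-* (+ suc ∣ a ∣) e))
      where
      isolate : ∀ a b → a + b ≡ 0ℤ → a ≡ - b
      isolate a b eq = trans (rearrange a b) (trans (cong (_- b) eq) (ℤ.+-identityˡ (- b)))
        where
        rearrange : ∀ a b → a ≡ a + b - b
        rearrange = solve-∀
  ... | zero  | p = ℤ.∣i∣≡0⇒i≡0 (trans p (ℕ.*-zeroʳ (suc ∣ a ∣)))
  ... | suc m | p = contradiction (ℕ.≤-trans (ℕ.m≤m*n (suc ∣ a ∣) (suc m)) (ℕ.≤-reflexive (≡.sym p))) (ℕ.<-irrefl refl)
  p-vanishes : ∀ q → 1 ℕ.≤ q → eval p (+ q) ≡ 0ℤ
  p-vanishes q@(suc _) 1≤q with ℤ.i*j≡0⇒i≡0∨j≡0 (+ q) {eval p (+ q)}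
    (trans (≡.sym (ℤ.+-identityˡ _)) (trans (cong (λ z → z + + q * eval p (+ q)) (≡.sym a≡0)) (h q 1≤q)))
  ... | inj₂ eq = eq

eval-zero : ∀ {p} → All (_≡ 0ℤ) p → ∀ x → eval p x ≡ 0ℤ
eval-zero []          x = refl
eval-zero (refl ∷ zs) x = trans (ℤ.+-identityˡ _) (trans (cong (x *_) (eval-zero zs x)) (ℤ.*-zeroʳ x))

deriv-zero : ∀ {p} → All (_≡ 0ℤ) p → All (_≡ 0ℤ) (deriv p)
deriv-zero []       = []
deriv-zero (_ ∷ zs) = aux 1 zs
  where
  aux : ∀ k {p} → All (_≡ 0ℤ) p → All (_≡ 0ℤ) (derivAux k p)
  aux k []          = []
  aux k (refl ∷ zs) = ℤ.*-zeroʳ (+ k) ∷ aux (suc k) zs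

module _ {p q : Poly} (agree : ∀ k → 1 ℕ.≤ k → eval p (+ k) ≡ eval q (+ k)) where
  private
    eval-difference : ∀ p q x → eval (p ⊞ -1ℤ ⊡ q) x ≡ eval p x - eval q x
    eval-difference p q x = trans (eval-⊞ p (-1ℤ ⊡ q) x)
      (cong (λ z → eval p x + z) (trans (eval-⊡ -1ℤ q x) (ℤ.-1*i≡-i _)))

    difference-zero : All (_≡ 0ℤ) (p ⊞ -1ℤ ⊡ q)
    difference-zero = vanishing⇒zero _ λ k 1≤k → trans (eval-difference p q (+ k)) (ℤ.i≡j⇒i-j≡0 (agree k 1≤k))

  eval-unique : ∀ x → eval p x ≡ eval q x
  eval-unique x = ℤ.i-j≡0⇒i≡j _ _ (trans (≡.sym (eval-difference p q x)) (eval-zero difference-zero x))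

  eval-deriv-unique : ∀ x → eval (deriv p) x ≡ eval (deriv q) x
  eval-deriv-unique x = ℤ.i-j≡0⇒i≡j _ _ (trans (≡.sym (eval-difference (deriv p) (deriv q) x))
    (trans (≡.sym (cong (λ r → eval r x) (trans (deriv-⊞ p (-1ℤ ⊡ q)) (cong (deriv p ⊞_) (deriv-⊡ -1ℤ q)))))
           (eval-zero (deriv-zero difference-zero) x)))

-- `deriv` acts on lists and not on functions, so a representing polynomial is carried along. By
-- `eval-deriv-unique` its choice does not affect f′.
record HasDerivative (f f′ : ℤ → ℤ) : Set where
  field
    poly       : Poly
    eval-poly  : ∀ x → eval poly x ≡ f x
    eval-deriv : ∀ x → eval (deriv poly) x ≡ f′ x
open HasDerivative

HasDerivative-cong : ∀ {f g f′ g′} → f ≗ g → f′ ≗ g′ → HasDerivative f f′ → HasDerivative g g′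
HasDerivative-cong f≗g f′≗g′ d = record
  { poly       = poly d
  ; eval-poly  = λ x → trans (eval-poly d x) (f≗g x)
  ; eval-deriv = λ x → trans (eval-deriv d x) (f′≗g′ x)
  }

const-derivative : ∀ c → HasDerivative (λ _ → c) (λ _ → 0ℤ)
const-derivative c = record
  { poly       = c ∷ []
  ; eval-poly  = λ x → trans (cong (λ z → c + z) (ℤ.*-zeroʳ x)) (ℤ.+-identityʳ c)
  ; eval-deriv = λ x → refl
  }

+-derivative : ∀ {f g f′ g′} → HasDerivative f f′ → HasDerivative g g′ →
               HasDerivative (λ x → f x + g x) (λ x → f′ x + g′ x)
+-derivative d e = record
  { poly       = poly d ⊞ poly e
  ; eval-poly  = λ x → trans (eval-⊞ (poly d) (poly e) x) (cong₂ _+_ (eval-poly d x) (eval-poly e x))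
  ; eval-deriv = λ x → trans (cong (λ r → eval r x) (deriv-⊞ (poly d) (poly e)))
      (trans (eval-⊞ (deriv (poly d)) (deriv (poly e)) x) (cong₂ _+_ (eval-deriv d x) (eval-deriv e x)))
  }

scale-derivative : ∀ c {f f′} → HasDerivative f f′ → HasDerivative (λ x → c * f x) (λ x → c * f′ x)
scale-derivative c d = record
  { poly       = c ⊡ poly d
  ; eval-poly  = λ x → trans (eval-⊡ c (poly d) x) (cong (c *_) (eval-poly d x))
  ; eval-deriv = λ x → trans (cong (λ r → eval r x) (deriv-⊡ c (poly d)))
      (trans (eval-⊡ c (deriv (poly d)) x) (cong (c *_) (eval-deriv d x)))
  }

x*-derivative : ∀ {f f′} → HasDerivative f f′ → HasDerivative (λ x → x * f x) (λ x → f x + x * f′ x)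
x*-derivative d = record
  { poly       = 0ℤ ∷ poly d
  ; eval-poly  = λ x → trans (ℤ.+-identityˡ _) (cong (x *_) (eval-poly d x))
  ; eval-deriv = λ x → trans (eval-deriv-∷ 0ℤ (poly d) x) (cong₂ (λ r s → r + x * s) (eval-poly d x) (eval-deriv d x))
  }

-- Lets a polynomial with unknown coefficients be differentiated through another representative of
-- the same function.
eval-deriv-≗ : ∀ {p f f′} → (∀ x → eval p x ≡ f x) → HasDerivative f f′ → ∀ x → eval (deriv p) x ≡ f′ x
eval-deriv-≗ {p} p≗f d x = trans (eval-deriv-unique {p} {poly d} (λ k _ → trans (p≗f (+ k)) (≡.sym (eval-poly d (+ k)))) x) (eval-deriv d x)

-- The algebra of set functions

SetFunction : ℕ → Set
SetFunction n = Subset n → ℤ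

∑⊆ : Subset n → SetFunction n → ℤ
∑⊆ []          F = F []
∑⊆ (false ∷ V) F = ∑⊆ V (F ∘ (false ∷_))
∑⊆ (true ∷ V)  F = ∑⊆ V (F ∘ (false ∷_)) + ∑⊆ V (F ∘ (true ∷_))

∑⊆-cong-⊆ : ∀ (V : Subset n) {F G} → (∀ W → W ⊆ V → F W ≡ G W) → ∑⊆ V F ≡ ∑⊆ V G
∑⊆-cong-⊆ []          F≗G = F≗G [] (λ ())
∑⊆-cong-⊆ (false ∷ V) F≗G = ∑⊆-cong-⊆ V λ W W⊆V → F≗G (false ∷ W) (out⊆ W⊆V)
∑⊆-cong-⊆ (true ∷ V)  F≗G = cong₂ _+_
  (∑⊆-cong-⊆ V λ W W⊆V → F≗G (false ∷ W) (out⊆ W⊆V))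
  (∑⊆-cong-⊆ V λ W W⊆V → F≗G (true ∷ W) (in⊆in W⊆V))

∑⊆-cong : ∀ (V : Subset n) {F G} → F ≗ G → ∑⊆ V F ≡ ∑⊆ V G
∑⊆-cong V F≗G = ∑⊆-cong-⊆ V λ W _ → F≗G W

∑⊆-+ : ∀ (V : Subset n) F G → ∑⊆ V (λ W → F W + G W) ≡ ∑⊆ V F + ∑⊆ V G
∑⊆-+ []          F G = refl
∑⊆-+ (false ∷ V) F G = ∑⊆-+ V _ _
∑⊆-+ (true ∷ V)  F G = trans (cong₂ _+_ (∑⊆-+ V _ _) (∑⊆-+ V _ _)) (interchange (∑⊆ V _) (∑⊆ V _) (∑⊆ V _) (∑⊆ V _))
  where
  interchange : ∀ a b c d → (a + b) + (c + d) ≡ (a + c) + (b + d)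
  interchange = solve-∀

∑⊆-* : ∀ (V : Subset n) c F → ∑⊆ V (λ W → c * F W) ≡ c * ∑⊆ V F
∑⊆-* []          c F = refl
∑⊆-* (false ∷ V) c F = ∑⊆-* V c _
∑⊆-* (true ∷ V)  c F = trans (cong₂ _+_ (∑⊆-* V c _) (∑⊆-* V c _)) (≡.sym (ℤ.*-distribˡ-+ c _ _))

∑⊆-zero : ∀ (V : Subset n) → ∑⊆ V (λ _ → 0ℤ) ≡ 0ℤ
∑⊆-zero []          = refl
∑⊆-zero (false ∷ V) = ∑⊆-zero V
∑⊆-zero (true ∷ V)  = cong₂ _+_ (∑⊆-zero V) (∑⊆-zero V)

-- Set functions under this product form ℤ[ε₁,…,εₙ] with εᵢ² = 0; splitting on
-- the first vertex writes f as f₀ + ε f₁, and all proofs below are inductions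
-- over these dual numbers.
infixr 7 _⋆_
_⋆_ : SetFunction n → SetFunction n → SetFunction n
(f ⋆ g) V = ∑⊆ V λ W → f W * g (V ─ W)

infix 8 _₀ _₁
_₀ _₁ : SetFunction (suc n) → SetFunction n
(f ₀) V = f (false ∷ V)
(f ₁) V = f (true ∷ V)

⋆-cong : ∀ {f f′ g g′ : SetFunction n} → f ≗ f′ → g ≗ g′ → f ⋆ g ≗ f′ ⋆ g′
⋆-cong f≗ g≗ V = ∑⊆-cong V λ W → cong₂ _*_ (f≗ W) (g≗ (V ─ W))

⋆-congˡ : ∀ (f : SetFunction n) {g g′} → g ≗ g′ → f ⋆ g ≗ f ⋆ g′
⋆-congˡ f g≗ = ⋆-cong {f = f} (λ _ → refl) g≗

⋆-congʳ : ∀ {f f′} (g : SetFunction n) → f ≗ f′ → f ⋆ g ≗ f′ ⋆ g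
⋆-congʳ {f′ = f′} g f≗ = ⋆-cong {f′ = f′} {g} {g} f≗ (λ _ → refl)

⋆-comm : ∀ (f g : SetFunction n) → f ⋆ g ≗ g ⋆ f
⋆-comm f g []          = ℤ.*-comm (f []) (g [])
⋆-comm f g (false ∷ V) = ⋆-comm (f ₀) (g ₀) V
-- The ε-coefficient of a product unfolds definitionally to `f ₀ ⋆ g ₁` plus `f ₁ ⋆ g ₀`; the later
-- clauses for `true ∷ V` rest on the same reduction.
⋆-comm f g (true ∷ V)  = trans (cong₂ _+_ (⋆-comm (f ₀) (g ₁) V) (⋆-comm (f ₁) (g ₀) V)) (ℤ.+-comm ((g ₁ ⋆ f ₀) V) _)

⋆-distribˡ-+ : ∀ (f g h : SetFunction n) V → (f ⋆ (λ U → g U + h U)) V ≡ (f ⋆ g) V + (f ⋆ h) V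
⋆-distribˡ-+ f g h V = trans (∑⊆-cong V λ W → ℤ.*-distribˡ-+ (f W) _ _) (∑⊆-+ V _ _)

⋆-distribʳ-+ : ∀ (f g h : SetFunction n) V → ((λ U → g U + h U) ⋆ f) V ≡ (g ⋆ f) V + (h ⋆ f) V
⋆-distribʳ-+ f g h V = trans (∑⊆-cong V λ W → ℤ.*-distribʳ-+ (f (V ─ W)) (g W) (h W)) (∑⊆-+ V _ _)

*-⋆ : ∀ c (f g : SetFunction n) V → ((λ U → c * f U) ⋆ g) V ≡ c * (f ⋆ g) V
*-⋆ c f g V = trans (∑⊆-cong V λ W → ℤ.*-assoc c (f W) _) (∑⊆-* V c _)

⋆-* : ∀ c (f g : SetFunction n) V → (f ⋆ (λ U → c * g U)) V ≡ c * (f ⋆ g) V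
⋆-* c f g V = trans (⋆-comm f (λ U → c * g U) V) (trans (*-⋆ c g f V) (cong (c *_) (⋆-comm g f V)))

⋆-assoc : ∀ (f g h : SetFunction n) → (f ⋆ g) ⋆ h ≗ f ⋆ (g ⋆ h)
⋆-assoc f g h []          = ℤ.*-assoc (f []) (g []) (h [])
⋆-assoc f g h (false ∷ V) = ⋆-assoc (f ₀) (g ₀) (h ₀) V
⋆-assoc f g h (true ∷ V)  = begin
  ((f ₀ ⋆ g ₀) ⋆ h ₁) V + ((λ U → (f ₀ ⋆ g ₁) U + (f ₁ ⋆ g ₀) U) ⋆ h ₀) V
    ≡⟨ cong₂ _+_ (⋆-assoc (f ₀) (g ₀) (h ₁) V) (⋆-distribʳ-+ (h ₀) (f ₀ ⋆ g ₁) (f ₁ ⋆ g ₀) V) ⟩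
  (f ₀ ⋆ (g ₀ ⋆ h ₁)) V + (((f ₀ ⋆ g ₁) ⋆ h ₀) V + ((f ₁ ⋆ g ₀) ⋆ h ₀) V)
    ≡⟨ cong (λ z → (f ₀ ⋆ (g ₀ ⋆ h ₁)) V + z) (cong₂ _+_ (⋆-assoc (f ₀) (g ₁) (h ₀) V) (⋆-assoc (f ₁) (g ₀) (h ₀) V)) ⟩
  (f ₀ ⋆ (g ₀ ⋆ h ₁)) V + ((f ₀ ⋆ (g ₁ ⋆ h ₀)) V + (f ₁ ⋆ (g ₀ ⋆ h ₀)) V)
    ≡⟨ ℤ.+-assoc ((f ₀ ⋆ (g ₀ ⋆ h ₁)) V) _ _ ⟨
  ((f ₀ ⋆ (g ₀ ⋆ h ₁)) V + (f ₀ ⋆ (g ₁ ⋆ h ₀)) V) + (f ₁ ⋆ (g ₀ ⋆ h ₀)) V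
    ≡⟨ cong (λ z → z + (f ₁ ⋆ (g ₀ ⋆ h ₀)) V) (⋆-distribˡ-+ (f ₀) (g ₀ ⋆ h ₁) (g ₁ ⋆ h ₀) V) ⟨
  (f ₀ ⋆ (λ U → (g ₀ ⋆ h ₁) U + (g ₁ ⋆ h ₀) U)) V + (f ₁ ⋆ (g ₀ ⋆ h ₀)) V ∎
  where open ≡-Reasoning

⋆-left-commute : ∀ (f g h : SetFunction n) → f ⋆ (g ⋆ h) ≗ g ⋆ (f ⋆ h)
⋆-left-commute f g h V = trans (≡.sym (⋆-assoc f g h V)) (trans (⋆-congʳ h (⋆-comm f g) V) (⋆-assoc g f h V))

δ : SetFunction n
δ []          = 1ℤ
δ (false ∷ V) = δ V
δ (true ∷ V)  = 0ℤ

⋆-zeroˡ : ∀ (f : SetFunction n) V → ((λ _ → 0ℤ) ⋆ f) V ≡ 0ℤ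
⋆-zeroˡ f V = trans (∑⊆-cong V λ W → ℤ.*-zeroˡ (f (V ─ W))) (∑⊆-zero V)

⋆-identityˡ : ∀ (f : SetFunction n) → δ ⋆ f ≗ f
⋆-identityˡ f []          = ℤ.*-identityˡ (f [])
⋆-identityˡ f (false ∷ V) = ⋆-identityˡ (f ₀) V
⋆-identityˡ f (true ∷ V)  = trans (cong₂ _+_ (⋆-identityˡ (f ₁) V) (⋆-zeroˡ (f ₀) V)) (ℤ.+-identityʳ _)

⋆-identityʳ : ∀ (f : SetFunction n) → f ⋆ δ ≗ f
⋆-identityʳ f V = trans (⋆-comm f δ V) (⋆-identityˡ f V)

-- Powers, the exponential and its derivative

infixr 8 _⋆^_
_⋆^_ : SetFunction n → ℕ → SetFunction n
f ⋆^ zero  = δ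
f ⋆^ suc k = f ⋆ (f ⋆^ k)

⋆^-cong : ∀ {f g : SetFunction n} k → f ≗ g → f ⋆^ k ≗ g ⋆^ k
⋆^-cong zero    f≗g V = refl
⋆^-cong {f = f} {g} (suc k) f≗g V = ⋆-cong {f′ = g} {f ⋆^ k} {g ⋆^ k} f≗g (⋆^-cong k f≗g) V

-- exp L x is the exponential e^{xL} of a set function L (whose value at ∅ is
-- ignored), i.e. the sum over set partitions of ∏ x L(block).
exp : SetFunction n → ℤ → SetFunction n
exp L x []          = 1ℤ
exp L x (false ∷ V) = exp (L ₀) x V
exp L x (true ∷ V)  = x * (L ₁ ⋆ exp (L ₀) x) V

exp-0 : ∀ (L : SetFunction n) → exp L 0ℤ ≗ δ
exp-0 L []          = refl
exp-0 L (false ∷ V) = exp-0 (L ₀) V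
exp-0 L (true ∷ V)  = refl

-- Since ε² = 0, exp(x(L₀ + εL₁)) = exp(xL₀)(1 + xεL₁), which is the last clause of `exp`. The
-- ε-coefficient of the product on the right is therefore (x + y) L₁ exp(xL₀) exp(yL₀).
exp-+ : ∀ (L : SetFunction n) x y → exp L (x + y) ≗ exp L x ⋆ exp L y
exp-+ L x y []          = refl
exp-+ L x y (false ∷ V) = exp-+ (L ₀) x y V
exp-+ L x y (true ∷ V)  = begin
  (x + y) * (L ₁ ⋆ exp (L ₀) (x + y)) V
    ≡⟨ cong ((x + y) *_) (⋆-congˡ (L ₁) (exp-+ (L ₀) x y) V) ⟩
  (x + y) * (L ₁ ⋆ (X ⋆ Y)) V
    ≡⟨ rearrange x y _ ⟩
  y * (L ₁ ⋆ (X ⋆ Y)) V + x * (L ₁ ⋆ (X ⋆ Y)) V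
    ≡⟨ cong₂ _+_ (cong (y *_) (⋆-left-commute (L ₁) X Y V)) (cong (x *_) (≡.sym (⋆-assoc (L ₁) X Y V))) ⟩
  y * (X ⋆ (L ₁ ⋆ Y)) V + x * ((L ₁ ⋆ X) ⋆ Y) V
    ≡⟨ cong₂ _+_ (⋆-* y X (L ₁ ⋆ Y) V) (*-⋆ x (L ₁ ⋆ X) Y V) ⟨
  (X ⋆ (λ U → y * (L ₁ ⋆ Y) U)) V + ((λ U → x * (L ₁ ⋆ X) U) ⋆ Y) V ∎
  where
  open ≡-Reasoning
  X = exp (L ₀) x
  Y = exp (L ₀) y
  rearrange : ∀ x y r → (x + y) * r ≡ y * r + x * r
  rearrange = solve-∀

exp-⋆^ : ∀ (L : SetFunction n) x k → exp L (+ k * x) ≗ exp L x ⋆^ k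
exp-⋆^ L x zero    V = trans (cong (λ y → exp L y V) (ℤ.*-zeroˡ x)) (exp-0 L V)
exp-⋆^ L x (suc k) V = trans (cong (λ y → exp L y V) (rearrange x (+ k)))
  (trans (exp-+ L x (+ k * x) V) (⋆-congˡ (exp L x) (exp-⋆^ L x k) V))
  where
  rearrange : ∀ x k → (1ℤ + k) * x ≡ x + k * x
  rearrange = solve-∀

∑⊆-derivative : ∀ (V : Subset n) {F F′ : ℤ → SetFunction n} →
  (∀ W → HasDerivative (λ x → F x W) (λ x → F′ x W)) →
  HasDerivative (λ x → ∑⊆ V (F x)) (λ x → ∑⊆ V (F′ x))
∑⊆-derivative []          d = d []
∑⊆-derivative (false ∷ V) d = ∑⊆-derivative V (d ∘ (false ∷_))
∑⊆-derivative (true ∷ V)  d = +-derivative (∑⊆-derivative V (d ∘ (false ∷_))) (∑⊆-derivative V (d ∘ (true ∷_)))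

⋆-derivative : ∀ (g : SetFunction n) {f f′ : ℤ → SetFunction n} →
  (∀ U → HasDerivative (λ x → f x U) (λ x → f′ x U)) →
  ∀ V → HasDerivative (λ x → (g ⋆ f x) V) (λ x → (g ⋆ f′ x) V)
⋆-derivative g d V = ∑⊆-derivative V λ W → scale-derivative (g W) (d (V ─ W))

∅ : Subset n
∅ = ⊥

-- At ∅ the exponential is the constant 1, with derivative 0, while `L ⋆ exp L x` takes the value
-- `L ∅` there; this is where `L ∅ ≡ 0ℤ` enters. With the first vertex present, the claim is the
-- product rule for x · (L₁ ⋆ exp(xL₀)).
exp-derivative : ∀ (L : SetFunction n) → L ∅ ≡ 0ℤ → ∀ V →
  HasDerivative (λ x → exp L x V) (λ x → (L ⋆ exp L x) V)
exp-derivative L L∅ []          = HasDerivative-cong (λ _ → refl) (λ x → ≡.sym (cong (_* 1ℤ) L∅)) (const-derivative 1ℤ)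
exp-derivative L L∅ (false ∷ V) = exp-derivative (L ₀) L∅ V
exp-derivative L L∅ (true ∷ V)  = HasDerivative-cong (λ _ → refl) product-rule
  (x*-derivative (⋆-derivative (L ₁) (exp-derivative (L ₀) L∅) V))
  where
  product-rule : ∀ x → (L ₁ ⋆ exp (L ₀) x) V + x * (L ₁ ⋆ (L ₀ ⋆ exp (L ₀) x)) V ≡ (L ⋆ exp L x) (true ∷ V)
  product-rule x = trans (ℤ.+-comm ((L ₁ ⋆ X) V) _) (cong (λ z → z + (L ₁ ⋆ X) V)
    (trans (cong (x *_) (⋆-left-commute (L ₁) (L ₀) (exp (L ₀) x) V)) (≡.sym (⋆-* x (L ₀) (L ₁ ⋆ X) V))))
    where
    X = exp (L ₀) x

eval-derivⁱ-exp : ∀ (L : SetFunction n) → L ∅ ≡ 0ℤ → ∀ V p → (∀ x → eval p x ≡ exp L x V) →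
  ∀ i x → eval (derivⁱ i p) x ≡ ((L ⋆^ i) ⋆ exp L x) V
eval-derivⁱ-exp L L∅ V p p≗ zero    x = trans (p≗ x) (≡.sym (⋆-identityˡ (exp L x) V))
eval-derivⁱ-exp L L∅ V p p≗ (suc i) x = trans
  (eval-deriv-≗ {derivⁱ i p} (eval-derivⁱ-exp L L∅ V p p≗ i) (⋆-derivative (L ⋆^ i) (exp-derivative L L∅) V) x)
  (trans (≡.sym (⋆-assoc (L ⋆^ i) L (exp L x) V)) (⋆-congʳ (exp L x) (⋆-comm (L ⋆^ i) L) V))

-- The two source identities determine the exponential

dropMin : Subset n → Subset n
dropMin []          = []
dropMin (false ∷ V) = false ∷ dropMin V
dropMin (true ∷ V)  = false ∷ V

record Logarithmic {n} (I A L : SetFunction n) : Set where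
  field
    I∅      : I ∅ ≡ 1ℤ
    A∅      : A ∅ ≡ 1ℤ
    inverse : I ⋆ A ≗ δ
    log     : ∀ V → Nonempty V → L V ≡ - ∑⊆ (dropMin V) λ W → I W * A (V ─ W)
open Logarithmic

tail-log : ∀ {I A L : SetFunction (suc n)} → Logarithmic I A L → Logarithmic (I ₀) (A ₀) (L ₀)
tail-log h = record
  { I∅ = I∅ h ; A∅ = A∅ h ; inverse = inverse h ∘ (false ∷_)
  ; log = λ V (u , u∈V) → log h (false ∷ V) (suc u , there u∈V) }

-- The minimum of `true ∷ V` is its first vertex and W avoids it, so the sum in `log` unfolds to
-- `(I ₀ ⋆ A ₁) V`.
head-log : ∀ {I A L : SetFunction (suc n)} → Logarithmic I A L → L ₁ ≗ λ V → - (I ₀ ⋆ A ₁) V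
head-log h V = log h (true ∷ V) (zero , here)

-- From L₁ = −I₀⋆A₁ and I₀⋆A₁ + I₁⋆A₀ = 0 one gets L₁ = I₁⋆A₀; multiply by I₀ resp. A₀.
exp-1 : ∀ {I A L : SetFunction n} → Logarithmic I A L → I ≗ exp L 1ℤ
exp-1 h []          = I∅ h
exp-1 h (false ∷ V) = exp-1 (tail-log h) V
exp-1 {I = I} {A} {L} h (true ∷ V) = begin
  (I ₁) V                     ≡⟨ ⋆-identityʳ (I ₁) V ⟨
  (I ₁ ⋆ δ) V                 ≡⟨ ⋆-congˡ (I ₁) (λ U → trans (⋆-comm (A ₀) (I ₀) U) (inverse h (false ∷ U))) V ⟨
  (I ₁ ⋆ (A ₀ ⋆ I ₀)) V       ≡⟨ ⋆-assoc (I ₁) (A ₀) (I ₀) V ⟨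
  ((I ₁ ⋆ A ₀) ⋆ I ₀) V       ≡⟨ ⋆-cong L₁≗I₁⋆A₀ (exp-1 (tail-log h)) V ⟩
  (L ₁ ⋆ exp (L ₀) 1ℤ) V      ≡⟨ ℤ.*-identityˡ _ ⟨
  1ℤ * (L ₁ ⋆ exp (L ₀) 1ℤ) V ∎
  where
  open ≡-Reasoning
  isolate : ∀ a b → a + b ≡ 0ℤ → b ≡ - a
  isolate a b eq = trans (rearrange a b) (trans (cong (_- a) eq) (ℤ.+-identityˡ (- a)))
    where
    rearrange : ∀ a b → b ≡ a + b - a
    rearrange = solve-∀
  L₁≗I₁⋆A₀ : I ₁ ⋆ A ₀ ≗ L ₁
  L₁≗I₁⋆A₀ U = trans (isolate ((I ₀ ⋆ A ₁) U) _ (inverse h (true ∷ U))) (≡.sym (head-log h U))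

exp-−1 : ∀ {I A L : SetFunction n} → Logarithmic I A L → A ≗ exp L -1ℤ
exp-−1 h []          = A∅ h
exp-−1 h (false ∷ V) = exp-−1 (tail-log h) V
exp-−1 {I = I} {A} {L} h (true ∷ V) = begin
  (A ₁) V                                ≡⟨ ⋆-identityˡ (A ₁) V ⟨
  (δ ⋆ A ₁) V                            ≡⟨ ⋆-congʳ (A ₁) (λ U → trans (⋆-comm (A ₀) (I ₀) U) (inverse h (false ∷ U))) V ⟨
  ((A ₀ ⋆ I ₀) ⋆ A ₁) V                  ≡⟨ ⋆-assoc (A ₀) (I ₀) (A ₁) V ⟩
  (A ₀ ⋆ (I ₀ ⋆ A ₁)) V                  ≡⟨ ⋆-congˡ (A ₀) {g′ = I ₀ ⋆ A ₁} (λ U → ℤ.neg-involutive _) V ⟨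
  (A ₀ ⋆ (λ U → - - (I ₀ ⋆ A ₁) U)) V    ≡⟨ ⋆-congˡ (A ₀) (λ U → trans (ℤ.-1*i≡-i _) (cong -_ (head-log h U))) V ⟨
  (A ₀ ⋆ (λ U → -1ℤ * (L ₁) U)) V        ≡⟨ ⋆-* -1ℤ (A ₀) (L ₁) V ⟩
  -1ℤ * (A ₀ ⋆ L ₁) V                    ≡⟨ cong (-1ℤ *_) (⋆-comm (A ₀) (L ₁) V) ⟩
  -1ℤ * (L ₁ ⋆ A ₀) V                    ≡⟨ cong (-1ℤ *_) (⋆-congˡ (L ₁) (exp-−1 (tail-log h)) V) ⟩
  -1ℤ * (L ₁ ⋆ exp (L ₀) -1ℤ) V          ∎
  where open ≡-Reasoning

-- Signs (-1)^|V| and the vanishing of high powers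

sgn : SetFunction n
sgn []          = 1ℤ
sgn (false ∷ V) = sgn V
sgn (true ∷ V)  = - sgn V

signed : SetFunction n → SetFunction n
signed f V = sgn V * f V

-- For W ⊆ V the signs of W and `V ─ W` multiply to that of V. In terms of dual numbers, `signed` is
-- the automorphism sending every ε to -ε.
signed-⋆ : ∀ (f g : SetFunction n) → signed f ⋆ signed g ≗ signed (f ⋆ g)
signed-⋆ f g []          = rearrange (f []) (g [])
  where
  rearrange : ∀ a b → (1ℤ * a) * (1ℤ * b) ≡ 1ℤ * (a * b)
  rearrange = solve-∀
signed-⋆ f g (false ∷ V) = signed-⋆ (f ₀) (g ₀) V
signed-⋆ f g (true ∷ V)  = begin
  (signed (f ₀) ⋆ (λ U → - sgn U * (g ₁) U)) V + ((λ U → - sgn U * (f ₁) U) ⋆ signed (g ₀)) V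
    ≡⟨ cong₂ _+_ (⋆-congˡ (signed (f ₀)) (neg (g ₁)) V) (⋆-congʳ (signed (g ₀)) (neg (f ₁)) V) ⟩
  (signed (f ₀) ⋆ (λ U → -1ℤ * signed (g ₁) U)) V + ((λ U → -1ℤ * signed (f ₁) U) ⋆ signed (g ₀)) V
    ≡⟨ cong₂ _+_ (⋆-* -1ℤ (signed (f ₀)) (signed (g ₁)) V) (*-⋆ -1ℤ (signed (f ₁)) (signed (g ₀)) V) ⟩
  -1ℤ * (signed (f ₀) ⋆ signed (g ₁)) V + -1ℤ * (signed (f ₁) ⋆ signed (g ₀)) V
    ≡⟨ cong₂ (λ a b → -1ℤ * a + -1ℤ * b) (signed-⋆ (f ₀) (g ₁) V) (signed-⋆ (f ₁) (g ₀) V) ⟩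
  -1ℤ * (sgn V * (f ₀ ⋆ g ₁) V) + -1ℤ * (sgn V * (f ₁ ⋆ g ₀) V)
    ≡⟨ rearrange (sgn V) _ _ ⟩
  - sgn V * ((f ₀ ⋆ g ₁) V + (f ₁ ⋆ g ₀) V) ∎
  where
  open ≡-Reasoning
  rearrange : ∀ s a b → -1ℤ * (s * a) + -1ℤ * (s * b) ≡ - s * (a + b)
  rearrange = solve-∀
  neg : ∀ (h : SetFunction _) U → - sgn U * h U ≡ -1ℤ * signed h U
  neg h U = lemma (sgn U) (h U)
    where
    lemma : ∀ s a → - s * a ≡ -1ℤ * (s * a)
    lemma = solve-∀

signed-δ : δ {n} ≗ signed δ
signed-δ []          = refl
signed-δ (false ∷ V) = signed-δ V
signed-δ (true ∷ V)  = ≡.sym (ℤ.*-zeroʳ (- sgn V))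

signed-⋆^ : ∀ (f : SetFunction n) k → signed f ⋆^ k ≗ signed (f ⋆^ k)
signed-⋆^ f zero    V = signed-δ V
signed-⋆^ f (suc k) V = trans (⋆-congˡ (signed f) (signed-⋆^ f k) V) (signed-⋆ f (f ⋆^ k) V)

*-⋆^ : ∀ c (f : SetFunction n) k V → ((λ U → c * f U) ⋆^ k) V ≡ c ^ k * (f ⋆^ k) V
*-⋆^ c f zero    V = ≡.sym (ℤ.*-identityˡ (δ V))
*-⋆^ c f (suc k) V = begin
  ((λ U → c * f U) ⋆ ((λ U → c * f U) ⋆^ k)) V ≡⟨ ⋆-congˡ (λ U → c * f U) (*-⋆^ c f k) V ⟩
  ((λ U → c * f U) ⋆ (λ U → c ^ k * (f ⋆^ k) U)) V ≡⟨ *-⋆ c f (λ U → c ^ k * (f ⋆^ k) U) V ⟩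
  c * (f ⋆ (λ U → c ^ k * (f ⋆^ k) U)) V ≡⟨ cong (c *_) (⋆-* (c ^ k) f (f ⋆^ k) V) ⟩
  c * (c ^ k * (f ⋆ (f ⋆^ k)) V) ≡⟨ ℤ.*-assoc c (c ^ k) _ ⟨
  c * c ^ k * (f ⋆ (f ⋆^ k)) V ∎
  where open ≡-Reasoning

sgn-⊤ : ∀ n → sgn (⊤ {n}) ≡ -1ℤ ^ n
sgn-⊤ zero    = refl
sgn-⊤ (suc n) = trans (cong -_ (sgn-⊤ n)) (≡.sym (ℤ.-1*i≡-i _))

-- As f vanishes at ∅, each factor must take at least one vertex, so k factors cannot share fewer
-- than k vertices.
⋆^-order : ∀ (f g : SetFunction n) → f ∅ ≡ 0ℤ → ∀ k V → ∣ V ∣ₛ ℕ.< k → ((f ⋆^ k) ⋆ g) V ≡ 0ℤ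
⋆^-order f g f∅ (suc k) V ∣V∣<k = trans (⋆-assoc f (f ⋆^ k) g V) (⋆-vanish f ((f ⋆^ k) ⋆ g) f∅ V
  (λ U ∣U∣<∣V∣ → ⋆^-order f g f∅ k U (ℕ.<-≤-trans ∣U∣<∣V∣ (ℕ.s≤s⁻¹ ∣V∣<k))))
  where
  ⋆-vanish-all : ∀ {n} (f h : SetFunction n) V → (∀ U → ∣ U ∣ₛ ℕ.≤ ∣ V ∣ₛ → h U ≡ 0ℤ) → (f ⋆ h) V ≡ 0ℤ
  ⋆-vanish-all f h V h-zero = trans
    (∑⊆-cong V λ W → trans (cong (f W *_) (h-zero (V ─ W) (∣p─q∣≤∣p∣ V W))) (ℤ.*-zeroʳ (f W)))
    (∑⊆-zero V)

  ⋆-vanish : ∀ {n} (f h : SetFunction n) → f ∅ ≡ 0ℤ → ∀ V → (∀ U → ∣ U ∣ₛ ℕ.< ∣ V ∣ₛ → h U ≡ 0ℤ) → (f ⋆ h) V ≡ 0ℤ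
  ⋆-vanish f h f∅ []          _      = cong (_* h []) f∅
  ⋆-vanish f h f∅ (false ∷ V) h-zero = ⋆-vanish (f ₀) (h ₀) f∅ V (λ U → h-zero (false ∷ U))
  -- If f leaves the first vertex to h, it must still take another one (recursion); once f has taken
  -- it, whatever remains is smaller than `true ∷ V`.
  ⋆-vanish f h f∅ (true ∷ V)  h-zero = cong₂ _+_
    (⋆-vanish (f ₀) (h ₁) f∅ V (λ U ∣U∣<∣V∣ → h-zero (true ∷ U) (ℕ.s≤s ∣U∣<∣V∣)))
    (⋆-vanish-all (f ₁) (h ₀) V (λ U ∣U∣≤∣V∣ → h-zero (false ∷ U) (ℕ.s≤s ∣U∣≤∣V∣)))

-- Finite sums, indicators and counting by enumeration

∑ : List A → (A → ℤ) → ℤ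
∑ []       f = 0ℤ
∑ (x ∷ xs) f = f x + ∑ xs f

∑-cong : ∀ (xs : List A) {f g} → f ≗ g → ∑ xs f ≡ ∑ xs g
∑-cong []       f≗g = refl
∑-cong (x ∷ xs) f≗g = cong₂ _+_ (f≗g x) (∑-cong xs f≗g)

∑-zero : ∀ (xs : List A) → ∑ xs (λ _ → 0ℤ) ≡ 0ℤ
∑-zero []       = refl
∑-zero (_ ∷ xs) = trans (ℤ.+-identityˡ _) (∑-zero xs)

∑-* : ∀ (xs : List A) c f → ∑ xs (λ x → c * f x) ≡ c * ∑ xs f
∑-* []       c f = ≡.sym (ℤ.*-zeroʳ c)
∑-* (x ∷ xs) c f = trans (cong (λ z → c * f x + z) (∑-* xs c f)) (≡.sym (ℤ.*-distribˡ-+ c (f x) _))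

∑-++ : ∀ (xs ys : List A) f → ∑ (xs List.++ ys) f ≡ ∑ xs f + ∑ ys f
∑-++ []       ys f = ≡.sym (ℤ.+-identityˡ _)
∑-++ (x ∷ xs) ys f = trans (cong (λ z → f x + z) (∑-++ xs ys f)) (≡.sym (ℤ.+-assoc (f x) _ _))

∑-map : ∀ (h : A → B) xs f → ∑ (List.map h xs) f ≡ ∑ xs (f ∘ h)
∑-map h []       f = refl
∑-map h (x ∷ xs) f = cong (λ z → f (h x) + z) (∑-map h xs f)

∑-cartesianProductWith : ∀ (h : A → B → C) xs ys f →
  ∑ (cartesianProductWith h xs ys) f ≡ ∑ xs λ x → ∑ ys λ y → f (h x y)
∑-cartesianProductWith h []       ys f = refl
∑-cartesianProductWith h (x ∷ xs) ys f = trans (∑-++ (List.map (h x) ys) _ f)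
  (cong₂ _+_ (∑-map (h x) ys f) (∑-cartesianProductWith h xs ys f))

∑⊆-∑-swap : ∀ (V : Subset n) (xs : List A) (F : Subset n → A → ℤ) →
  ∑⊆ V (λ W → ∑ xs (F W)) ≡ ∑ xs λ x → ∑⊆ V λ W → F W x
∑⊆-∑-swap V []       F = ∑⊆-zero V
∑⊆-∑-swap V (x ∷ xs) F = trans (∑⊆-+ V (λ W → F W x) (λ W → ∑ xs (F W)))
  (cong (λ z → ∑⊆ V (λ W → F W x) + z) (∑⊆-∑-swap V xs F))

-- The Iverson bracket: cardinalities become sums in ℤ, where signs and products are available.
⟦_⟧ : {X : Set} → Dec X → ℤ
⟦ d ⟧ = if does d then 1ℤ else 0ℤ

module _ {X Y : Set} where
  ⟦⟧-⇔ : (x? : Dec X) (y? : Dec Y) → (X → Y) → (Y → X) → ⟦ x? ⟧ ≡ ⟦ y? ⟧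
  ⟦⟧-⇔ (yes _) (yes _) _ _ = refl
  ⟦⟧-⇔ (no _)  (no _)  _ _ = refl
  ⟦⟧-⇔ (yes x) (no ¬y) f _ = contradiction (f x) ¬y
  ⟦⟧-⇔ (no ¬x) (yes y) _ g = contradiction (g y) ¬x

  ⟦⟧-× : (x? : Dec X) (y? : Dec Y) → ⟦ x? ×-dec y? ⟧ ≡ ⟦ x? ⟧ * ⟦ y? ⟧
  ⟦⟧-× (yes _) (yes _) = refl
  ⟦⟧-× (yes _) (no _)  = refl
  ⟦⟧-× (no _)  _       = refl

⟦⟧-no : {X : Set} (x? : Dec X) → ¬ X → ⟦ x? ⟧ ≡ 0ℤ
⟦⟧-no (yes x) ¬x = contradiction x ¬x
⟦⟧-no (no _)  _  = refl

⟦⟧-yes : {X : Set} (x? : Dec X) → X → ⟦ x? ⟧ ≡ 1ℤ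
⟦⟧-yes (yes _) _ = refl
⟦⟧-yes (no ¬x) x = contradiction x ¬x

record Enumeration (A : Set) : Set where
  field
    elements : List A
    unique   : Unique elements
    complete : ∀ a → a Membership.∈ elements
open Enumeration

∑ₑ : Enumeration A → (A → ℤ) → ℤ
∑ₑ e = ∑ (elements e)

enum-Bool : Enumeration Bool
enum-Bool = record
  { elements = false ∷ true ∷ []
  ; unique   = ((λ ()) ∷ []) ∷ [] ∷ []
  ; complete = λ { false → here refl ; true → there (here refl) }
  }

enum-Fin : ∀ n → Enumeration (Fin n)
enum-Fin n = record { elements = allFin n ; unique = Unique.allFin⁺ n ; complete = Membership.∈-allFin }

enum-× : Enumeration A → Enumeration B → Enumeration (A × B)
enum-× d e = record
  { elements = cartesianProductWith _,_ (elements d) (elements e)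
  ; unique   = Unique.cartesianProductWith⁺ _,_ (λ { refl → refl , refl }) (unique d) (unique e)
  ; complete = λ (a , b) → Membership.∈-cartesianProductWith⁺ _,_ (complete d a) (complete e b)
  }

enum-Vec : Enumeration A → ∀ l → Enumeration (Vec A l)
enum-Vec e zero = record
  { elements = [] ∷ [] ; unique = [] ∷ [] ; complete = λ { [] → here refl } }
enum-Vec e (suc l) = record
  { elements = cartesianProductWith _∷_ (elements e) (elements (enum-Vec e l))
  ; unique   = Unique.cartesianProductWith⁺ _∷_ (λ { refl → refl , refl }) (unique e) (unique (enum-Vec e l))
  ; complete = λ { (a ∷ as) → Membership.∈-cartesianProductWith⁺ _∷_ (complete e a) (complete (enum-Vec e l) as) }
  }

enum-Subset : ∀ n → Enumeration (Subset n)
enum-Subset = enum-Vec enum-Bool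

∃? : {P : A → Set} (e : Enumeration A) → Decidable P → Dec (∃ P)
∃? e P? = Dec.map′ (λ any → let a , _ , p = Membership.find any in a , p)
                   (λ (a , p) → Membership.lose (complete e a) p)
                   (Any.any? P? (elements e))

-- Bridge between the recursive sum, which computes along the first vertex, and sums over an
-- enumeration, which counting produces.
∑⊆-∑ : ∀ (V : Subset n) F → ∑⊆ V F ≡ ∑ₑ (enum-Subset n) λ U → ⟦ U ⊆? V ⟧ * F U
∑⊆-∑ []      F = ≡.sym (trans (ℤ.+-identityʳ _) (ℤ.*-identityˡ (F [])))
∑⊆-∑ {suc n} (v ∷ V) F = ≡.sym (trans
  (∑-cartesianProductWith _∷_ (false ∷ true ∷ []) subsets (λ U → ⟦ U ⊆? v ∷ V ⟧ * F U))
  (trans (cong (λ z → z + (∑ subsets (λ U → ⟦ true ∷ U ⊆? v ∷ V ⟧ * F (true ∷ U)) + 0ℤ)) false-part) (true-part v)))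
  where
  subsets = elements (enum-Subset n)
  false-part : ∑ subsets (λ U → ⟦ false ∷ U ⊆? v ∷ V ⟧ * F (false ∷ U)) ≡ ∑⊆ V (F ∘ (false ∷_))
  false-part = trans (∑-cong subsets λ U → cong (_* F (false ∷ U))
      (⟦⟧-⇔ (false ∷ U ⊆? v ∷ V) (U ⊆? V) drop-∷-⊆ out⊆)) (≡.sym (∑⊆-∑ V _))
  true-part : ∀ v → ∑⊆ V (F ∘ (false ∷_)) + (∑ subsets (λ U → ⟦ true ∷ U ⊆? v ∷ V ⟧ * F (true ∷ U)) + 0ℤ) ≡ ∑⊆ (v ∷ V) F
  true-part false = trans (cong (λ z → ∑⊆ V (F ∘ (false ∷_)) + z) (trans (ℤ.+-identityʳ _)
    (trans (∑-cong subsets λ U → ℤ.*-zeroˡ (F (true ∷ U))) (∑-zero subsets)))) (ℤ.+-identityʳ _)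
  true-part true  = cong (λ z → ∑⊆ V (F ∘ (false ∷_)) + z) (trans (ℤ.+-identityʳ _)
    (trans (∑-cong subsets λ U → cong (_* F (true ∷ U))
      (⟦⟧-⇔ (true ∷ U ⊆? true ∷ V) (U ⊆? V) drop-∷-⊆ in⊆in)) (≡.sym (∑⊆-∑ V _))))

module _ (e : Enumeration A) {P : A → Set} (P? : Decidable P) where
  card : ℕ
  card = length (filter P? (elements e))

  +card : + card ≡ ∑ₑ e λ a → ⟦ P? a ⟧
  +card = go (elements e)
    where
    go : ∀ xs → + length (filter P? xs) ≡ ∑ xs λ a → ⟦ P? a ⟧
    go []       = refl
    go (x ∷ xs) with P? x
    ... | yes _ = cong (λ z → 1ℤ + z) (go xs)
    ... | no  _ = trans (go xs) (≡.sym (ℤ.+-identityˡ _))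

  -- Proofs in a `Refinement` are irrelevant: values alone settle equality, and `recompute` regains
  -- a proof of P from its decision.
  card-↔ : HasCard (Refinement A P) card
  card-↔ = mk↔ₛ′ to from to∘from from∘to
    where
    ys = filter P? (elements e)
    ys! : Unique ys
    ys! = Unique.filter⁺ P? (unique e)
    ∈ys : ∀ a → .(P a) → a Membership.∈ ys
    ∈ys a p = Membership.∈-filter⁺ P? (complete e a) (recompute (P? a) p)
    to : Fin card → Refinement A P
    to i = List.lookup ys i , [ proj₂ (Membership.∈-filter⁻ P? {xs = elements e} (Membership.∈-lookup {xs = ys} i)) ]
    from : Refinement A P → Fin card
    from (a , [ p ]) = Any.index (∈ys a p)
    to∘from : ∀ r → to (from r) ≡ r
    to∘from (a , [ p ]) = value-injective (≡.sym (lookup-index (∈ys a p)))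
    lookup-injective : ∀ {ys : List A} → Unique ys → ∀ i j → List.lookup ys i ≡ List.lookup ys j → i ≡ j
    lookup-injective (_ ∷ _)    zero    zero    _  = refl
    lookup-injective (y∉ ∷ _)   zero    (suc j) eq = contradiction eq (All.lookup y∉ (Membership.∈-lookup j))
    lookup-injective (y∉ ∷ _)   (suc i) zero    eq = contradiction (≡.sym eq) (All.lookup y∉ (Membership.∈-lookup i))
    lookup-injective (_ ∷ ys!)  (suc i) (suc j) eq = cong suc (lookup-injective ys! i j eq)
    from∘to : ∀ i → from (to i) ≡ i
    from∘to i = lookup-injective ys! _ _ (≡.sym (lookup-index (∈ys (List.lookup ys i) _)))

HasCard-unique : ∀ {X Y k l} → HasCard X k → HasCard Y l → X ↔ Y → k ≡ l
HasCard-unique X-card Y-card X↔Y = ↔⇒≡ (↔-sym Y-card ↔-∘ (X↔Y ↔-∘ X-card))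

-- `to` and `from` are total but mutually inverse only on the counted elements, so the comparison is
-- made between the two refinements.
∑-bijection : {P : A → Set} {Q : B → Set} (d : Enumeration A) (e : Enumeration B) (P? : Decidable P) (Q? : Decidable Q) →
  (to : A → B) (from : B → A) →
  (∀ {a} → P a → Q (to a)) → (∀ {b} → Q b → P (from b)) →
  (∀ {a} → P a → from (to a) ≡ a) → (∀ {b} → Q b → to (from b) ≡ b) →
  ∑ₑ d (λ a → ⟦ P? a ⟧) ≡ ∑ₑ e (λ b → ⟦ Q? b ⟧)
∑-bijection {P = P} {Q} d e P? Q? to from P⇒Q Q⇒P from∘to to∘from =
  trans (≡.sym (+card d P?)) (trans (cong +_ (HasCard-unique (card-↔ d P?) (card-↔ e Q?) P↔Q)) (+card e Q?))
  where
  P↔Q : Refinement _ P ↔ Refinement _ Q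
  P↔Q = mk↔ₛ′
    (λ { (a , [ p ]) → to a , [ P⇒Q p ] })
    (λ { (b , [ q ]) → from b , [ Q⇒P q ] })
    (λ { (b , [ q ]) → value-injective (to∘from (recompute (Q? b) q)) })
    (λ { (a , [ p ]) → value-injective (from∘to (recompute (P? a) p)) })

δ-⟦⟧ : ∀ (V : Subset n) → δ V ≡ ⟦ ¬? (nonempty? V) ⟧
δ-⟦⟧ []          = refl
δ-⟦⟧ (false ∷ V) = trans (δ-⟦⟧ V) (⟦⟧-⇔ (¬? (nonempty? V)) (¬? (nonempty? (false ∷ V)))
  (λ { empty (suc v , there v∈V) → empty (v , v∈V) }) (λ { empty (v , v∈V) → empty (suc v , there v∈V) }))
δ-⟦⟧ (true ∷ V)  = ≡.sym (⟦⟧-no (¬? (nonempty? (true ∷ V))) (λ empty → empty (zero , here)))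

-- Products with one factor per block, and colourings

⨂ : ∀ {l} → (Fin l → SetFunction n) → SetFunction n
⨂ {l = zero}  F = δ
⨂ {l = suc l} F = F zero ⋆ ⨂ (F ∘ suc)

⨂-cong : ∀ {l} {F G : Fin l → SetFunction n} → (∀ k → F k ≗ G k) → ⨂ F ≗ ⨂ G
⨂-cong {l = zero}          F≗G V = refl
⨂-cong {l = suc l} {F} {G} F≗G V = ⋆-cong {f′ = G zero} {⨂ (F ∘ suc)} {⨂ (G ∘ suc)} (F≗G zero) (⨂-cong (F≗G ∘ suc)) V

⨂-const : ∀ l (f : SetFunction n) → ⨂ {l = l} (λ _ → f) ≗ f ⋆^ l
⨂-const zero    f V = refl
⨂-const (suc l) f V = ⋆-congˡ f (⨂-const l f) V

∏ : ∀ {q} → (Fin q → ℤ) → ℤ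
∏ {zero}  f = 1ℤ
∏ {suc q} f = f zero * ∏ (f ∘ suc)

∏-cong : ∀ {q} {f g : Fin q → ℤ} → f ≗ g → ∏ f ≡ ∏ g
∏-cong {zero}  f≗g = refl
∏-cong {suc q} f≗g = cong₂ _*_ (f≗g zero) (∏-cong (f≗g ∘ suc))

⟦⟧-∀ : ∀ {q} {P : Fin q → Set} (P? : Decidable P) → ⟦ Fin.all? P? ⟧ ≡ ∏ λ k → ⟦ P? k ⟧
⟦⟧-∀ {zero}  P? = refl
⟦⟧-∀ {suc q} P? = trans
  (⟦⟧-⇔ (Fin.all? P?) (P? zero ×-dec Fin.all? (P? ∘ suc))
    (λ p → p zero , p ∘ suc) (λ { (p₀ , p) zero → p₀ ; (p₀ , p) (suc k) → p k }))
  (trans (⟦⟧-× (P? zero) (Fin.all? (P? ∘ suc))) (cong (⟦ P? zero ⟧ *_) (⟦⟧-∀ (P? ∘ suc))))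

∑-tabulate : ∀ {q} (h : Fin q → A) f → ∑ (List.tabulate h) f ≡ ∑ (allFin q) (f ∘ h)
∑-tabulate h f = trans (cong (λ xs → ∑ xs f) (≡.sym (List.map-tabulate id h))) (∑-map h (allFin _) f)

∑-⋆ : ∀ (xs : List A) (f : SetFunction n) (g : A → SetFunction n) V →
      ∑ xs (λ x → (f ⋆ g x) V) ≡ (f ⋆ λ U → ∑ xs λ x → g x U) V
∑-⋆ xs f g V = trans (≡.sym (∑⊆-∑-swap V xs λ W x → f W * g x (V ─ W)))
  (∑⊆-cong V λ W → ∑-* xs (f W) λ x → g x (V ─ W))

⨂-₀ : ∀ {q} (F : Fin q → SetFunction (suc n)) → ⨂ (λ k → F k ₀) ≗ (⨂ F) ₀
⨂-₀ {q = zero}  F V = refl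
⨂-₀ {q = suc q} F V = ⋆-congˡ (F zero ₀) (⨂-₀ (F ∘ suc)) V

-- Leibniz rule for the ε-coefficient of a product: exactly one factor x receives the first vertex.
⨂-₁ : ∀ {q} (F : Fin q → SetFunction (suc n)) V →
  ∑ (allFin q) (λ x → ⨂ (λ k U → F k (does (k Fin.≟ x) ∷ U)) V) ≡ (⨂ F ₁) V
⨂-₁ {q = zero}  F V = refl
⨂-₁ {q = suc q} F V = trans (cong₂ _+_ (⋆-congˡ (F zero ₁) (⨂-₀ (F ∘ suc)) V) other-colours)
  (ℤ.+-comm ((F zero ₁ ⋆ (⨂ (F ∘ suc)) ₀) V) _)
  where
  other-colours : ∑ (List.tabulate suc) (λ x → ⨂ (λ k U → F k (does (k Fin.≟ x) ∷ U)) V) ≡ (F zero ₀ ⋆ ⨂ (F ∘ suc) ₁) V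
  other-colours = trans (∑-tabulate suc (λ x → ⨂ (λ k U → F k (does (k Fin.≟ x) ∷ U)) V))
    (trans (∑-⋆ (allFin q) (F zero ₀) (λ x → ⨂ (λ k U → F (suc k) (does (k Fin.≟ x) ∷ U))) V)
           (⋆-congˡ (F zero ₀) (⨂-₁ (F ∘ suc)) V))

colourClass : ∀ {q} → Fin q → Vec (Fin q) n → Subset n
colourClass k = Vec.map λ x → does (k Fin.≟ x)

-- The factors must be allowed to depend on the colour: once the first vertex has colour x, `F x` is
-- evaluated at sets containing it and every other factor at sets avoiding it, so even equal factors
-- become unequal in the induction.
∑-colourings : ∀ n {q} (F : Fin q → SetFunction n) →
  ∑ₑ (enum-Vec (enum-Fin q) n) (λ c → ∏ λ k → F k (colourClass k c)) ≡ ⨂ F ⊤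
∑-colourings zero    F = trans (ℤ.+-identityʳ _) (empty F)
  where
  empty : ∀ {q} (F : Fin q → SetFunction 0) → ∏ (λ k → F k []) ≡ ⨂ F []
  empty {zero}  F = refl
  empty {suc q} F = cong (F zero [] *_) (empty (F ∘ suc))
∑-colourings (suc n) {q} F = trans
  (∑-cartesianProductWith _∷_ (allFin q) (Enumeration.elements (enum-Vec (enum-Fin q) n)) (λ c → ∏ λ k → F k (colourClass k c)))
  (trans (∑-cong (allFin q) λ x → ∑-colourings n (λ k U → F k (does (k Fin.≟ x) ∷ U))) (⨂-₁ F ⊤))

∈-colourClass⁺ : ∀ {q} (c : Vec (Fin q) n) {u} → u ∈ colourClass (lookup c u) c
∈-colourClass⁺ c {u} = Vec.lookup⇒[]= u _ (trans (Vec.lookup-map u _ c) (dec-true (lookup c u Fin.≟ lookup c u) refl))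

∈-colourClass⁻ : ∀ {q} (c : Vec (Fin q) n) {k u} → u ∈ colourClass k c → lookup c u ≡ k
∈-colourClass⁻ c {k} {u} u∈ with k Fin.≟ lookup c u | trans (≡.sym (Vec.lookup-map u (λ x → does (k Fin.≟ x)) c)) (Vec.[]=⇒lookup u∈)
... | yes eq | _ = ≡.sym eq
... | no _   | ()

-- Tuples of blocks as iterated convolutions

enum-Orient : ∀ n → Enumeration (Orient n)
enum-Orient n = enum-Vec (enum-Subset n) n

enum-block : ∀ n → Enumeration (Subset n × Orient n)
enum-block n = enum-× (enum-Subset n) (enum-Orient n)

BlockProperty : ℕ → ℕ → Set₁
BlockProperty n l = Fin l → Subset n → Orient n → Set

-- Validity of a tuple relative to a set V in place of [n], so that a block can be removed and the
-- rest treated in the same way.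
record IsPartition {l} (Q : BlockProperty n l) (V : Subset n) (t : RawTuple n l) : Set where
  field
    disjoint : ∀ k k′ → k ≢ k′ → ∀ v → ¬ (v ∈ blk t k × v ∈ blk t k′)
    covers   : ∀ v → v ∈ V → ∃ λ k → v ∈ blk t k
    inside   : ∀ k v → v ∈ blk t k → v ∈ V
    good     : ∀ k → Q k (blk t k) (ori t k)

-- Recursive form of `IsPartition`: choosing U ⊆ V and continuing in `V ─ U` is the shape of `_⋆_`,
-- and disjointness becomes implicit.
Peeled : ∀ {l} → BlockProperty n l → Subset n → RawTuple n l → Set
Peeled Q V []            = ¬ Nonempty V
Peeled Q V ((U , γ) ∷ t) = U ⊆ V × Q zero U γ × Peeled (Q ∘ suc) (V ─ U) t

x∈p─q⇒x∉q : ∀ {p q : Subset n} {x} → x ∈ p ─ q → ¬ x ∈ q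
x∈p─q⇒x∉q {p = _ ∷ _} {q = false ∷ _} here       ()
x∈p─q⇒x∉q {p = _ ∷ _} {q = _ ∷ _}    (there x∈) (there x∈q) = x∈p─q⇒x∉q x∈ x∈q

Peeled⇒IsPartition : ∀ {l} {Q : BlockProperty n l} V t → Peeled Q V t → IsPartition Q V t
Peeled⇒IsPartition V [] empty = record
  { disjoint = λ () ; covers = λ v v∈V → contradiction (v , v∈V) empty ; inside = λ () ; good = λ () }
Peeled⇒IsPartition V ((U , γ) ∷ t) (U⊆V , q , peeled) = record
  { disjoint = λ where
      zero    zero     0≢0   v _            → 0≢0 refl
      zero    (suc k′) _     v (v∈U , v∈k′) → x∈p─q⇒x∉q {p = V} (inside k′ v v∈k′) v∈U
      (suc k) zero     _     v (v∈k , v∈U)  → x∈p─q⇒x∉q {p = V} (inside k v v∈k) v∈U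
      (suc k) (suc k′) k≢k′  v              → disjoint k k′ (k≢k′ ∘ cong suc) v
  ; covers = λ v v∈V → cover v v∈V (v ∈? U)
  ; inside = λ where
      zero    v v∈U → U⊆V v∈U
      (suc k) v v∈k → p─q⊆p V U (inside k v v∈k)
  ; good = λ where
      zero    → q
      (suc k) → good k
  }
  where
  open IsPartition (Peeled⇒IsPartition (V ─ U) t peeled)
  cover : ∀ v → v ∈ V → Dec (v ∈ U) → ∃ λ k → v ∈ blk ((U , γ) ∷ t) k
  cover v v∈V (yes v∈U) = zero , v∈U
  cover v v∈V (no v∉U)  = let k , v∈k = covers v (x∈p∧x∉q⇒x∈p─q v∈V v∉U) in suc k , v∈k

IsPartition⇒Peeled : ∀ {l} {Q : BlockProperty n l} V t → IsPartition Q V t → Peeled Q V t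
IsPartition⇒Peeled V [] isP (v , v∈V) with () ← proj₁ (IsPartition.covers isP v v∈V)
IsPartition⇒Peeled {Q = Q} V ((U , γ) ∷ t) isP = inside zero _ , good zero , IsPartition⇒Peeled (V ─ U) t rest
  where
  open IsPartition isP
  rest : IsPartition (Q ∘ suc) (V ─ U) t
  rest = record
    { disjoint = λ k k′ k≢k′ → disjoint (suc k) (suc k′) (k≢k′ ∘ Fin.suc-injective)
    ; covers   = λ v v∈V─U → case-suc v v∈V─U (covers v (p─q⊆p V U v∈V─U))
    ; inside   = λ k v v∈k → x∈p∧x∉q⇒x∈p─q (inside (suc k) v v∈k) (λ v∈U → disjoint zero (suc k) (λ ()) v (v∈U , v∈k))
    ; good     = good ∘ suc
    }
    where
    case-suc : ∀ v → v ∈ V ─ U → (∃ λ k → v ∈ blk ((U , γ) ∷ t) k) → ∃ λ k → v ∈ blk t k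
    case-suc v v∈V─U (zero , v∈U)  = contradiction v∈U (x∈p─q⇒x∉q {p = V} v∈V─U)
    case-suc v v∈V─U (suc k , v∈k) = k , v∈k

peeled? : ∀ {l} {Q : BlockProperty n l} → (∀ k U γ → Dec (Q k U γ)) → ∀ V t → Dec (Peeled Q V t)
peeled? Q? V []            = ¬? (nonempty? V)
peeled? Q? V ((U , γ) ∷ t) = (U ⊆? V) ×-dec (Q? zero U γ ×-dec peeled? (Q? ∘ suc) (V ─ U) t)

#orientations : {Q : Subset n → Orient n → Set} → (∀ U γ → Dec (Q U γ)) → SetFunction n
#orientations Q? U = ∑ₑ (enum-Orient _) λ γ → ⟦ Q? U γ ⟧

-- The later blocks depend on the first only through `V ─ U`, so the indicator factors and the sums
-- over γ and t separate.
∑-peeled : ∀ {n l} {Q : BlockProperty n l} (Q? : ∀ k U γ → Dec (Q k U γ)) V →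
  ∑ₑ (enum-Vec (enum-block n) l) (λ t → ⟦ peeled? Q? V t ⟧) ≡ ⨂ (#orientations ∘ Q?) V
∑-peeled {l = zero}      Q? V = trans (ℤ.+-identityʳ _) (≡.sym (δ-⟦⟧ V))
∑-peeled {n} {suc l} {Q} Q? V = begin
  ∑ (elements (enum-Vec (enum-block n) (suc l))) (λ t → ⟦ peeled? Q? V t ⟧)
    ≡⟨ ∑-cartesianProductWith _∷_ (elements (enum-block n)) tuples _ ⟩
  ∑ (elements (enum-block n)) (λ { (U , γ) → ∑ tuples λ t → ⟦ peeled? Q? V ((U , γ) ∷ t) ⟧ })
    ≡⟨ ∑-cartesianProductWith _,_ subsets orients _ ⟩
  ∑ subsets (λ U → ∑ orients λ γ → ∑ tuples λ t → ⟦ peeled? Q? V ((U , γ) ∷ t) ⟧)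
    ≡⟨ (∑-cong subsets λ U → factor U) ⟩
  ∑ subsets (λ U → ⟦ U ⊆? V ⟧ * (#orientations (Q? zero) U * ⨂ (#orientations ∘ Q? ∘ suc) (V ─ U)))
    ≡⟨ ∑⊆-∑ V _ ⟨
  ⨂ (#orientations ∘ Q?) V ∎
  where
  open ≡-Reasoning
  open Enumeration
  tuples  = elements (enum-Vec (enum-block n) l)
  subsets = elements (enum-Subset n)
  orients = elements (enum-Orient n)

  factor : ∀ U → ∑ orients (λ γ → ∑ tuples λ t → ⟦ peeled? Q? V ((U , γ) ∷ t) ⟧) ≡
                 ⟦ U ⊆? V ⟧ * (#orientations (Q? zero) U * ⨂ (#orientations ∘ Q? ∘ suc) (V ─ U))
  factor U = begin
    ∑ orients (λ γ → ∑ tuples λ t → ⟦ peeled? Q? V ((U , γ) ∷ t) ⟧)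
      ≡⟨ (∑-cong orients λ γ → trans (∑-cong tuples λ t → trans
           (⟦⟧-× (U ⊆? V) (Q? zero U γ ×-dec peeled? (Q? ∘ suc) (V ─ U) t))
           (cong (⟦ U ⊆? V ⟧ *_) (⟦⟧-× (Q? zero U γ) (peeled? (Q? ∘ suc) (V ─ U) t))))
         (trans (∑-* tuples ⟦ U ⊆? V ⟧ _) (cong (⟦ U ⊆? V ⟧ *_)
           (trans (∑-* tuples ⟦ Q? zero U γ ⟧ _) (trans (cong (⟦ Q? zero U γ ⟧ *_) (∑-peeled (Q? ∘ suc) (V ─ U)))
             (ℤ.*-comm ⟦ Q? zero U γ ⟧ rest)))))) ⟩
    ∑ orients (λ γ → ⟦ U ⊆? V ⟧ * (rest * ⟦ Q? zero U γ ⟧))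
      ≡⟨ trans (∑-* orients ⟦ U ⊆? V ⟧ _) (cong (⟦ U ⊆? V ⟧ *_) (trans (∑-* orients rest _) (ℤ.*-comm rest _))) ⟩
    ⟦ U ⊆? V ⟧ * (#orientations (Q? zero) U * rest) ∎
    where rest = ⨂ (#orientations ∘ Q? ∘ suc) (V ─ U)

-- Deciding the properties of orientations

Arc-mono-Acyclic : {M N : Orient n} → (∀ u v → Arc M u v → Arc N u v) → Acyclic N → Acyclic M
Arc-mono-Acyclic M⊆N acyclic (m , v , injective , arcs , closing) =
  acyclic (m , v , injective , (λ k → M⊆N _ _ (arcs k)) , M⊆N _ _ closing)

arc? : (M : Orient n) → ∀ u v → Dec (Arc M u v)
arc? M u v = lookup (lookup M u) v Bool.≟ true

edge? : (G : Graph n) → ∀ u v → Dec (Edge G u v)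
edge? G u v = adj G u v Bool.≟ true

IsCycle : Orient n → ∀ {m} → (Fin (suc (suc m)) → Fin n) → Set
IsCycle M {m} v = Injective _≡_ _≡_ v × (∀ k → Arc M (v (inject₁ k)) (v (suc k))) × Arc M (v (fromℕ (suc m))) (v zero)

isCycle? : (M : Orient n) → ∀ {m} (v : Fin (suc (suc m)) → Fin n) → Dec (IsCycle M v)
isCycle? M v =
  Dec.map′ (λ inj {i} {j} → inj i j) (λ inj i j → inj {i} {j})
    (Fin.all? λ i → Fin.all? λ j → (v i Fin.≟ v j) →-dec (i Fin.≟ j))
  ×-dec (Fin.all? λ k → arc? M _ _) ×-dec arc? M _ _

IsCycle-cong : ∀ (M : Orient n) {m} {v w : Fin (suc (suc m)) → Fin n} → v ≗ w → IsCycle M v → IsCycle M w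
IsCycle-cong M v≗w (injective , arcs , closing) =
  (λ eq → injective (trans (v≗w _) (trans eq (≡.sym (v≗w _))))) ,
  (λ k → ≡.subst₂ (Arc M) (v≗w _) (v≗w _) (arcs k)) ,
  ≡.subst₂ (Arc M) (v≗w _) (v≗w _) closing

-- A cycle visits distinct vertices, so m + 2 ≤ n and a search over m < n is exhaustive. Vertex
-- sequences are searched as vectors, which can be enumerated.
acyclic? : (M : Orient n) → Dec (Acyclic M)
acyclic? {n} M = ¬? (Dec.map′ to from
  (Fin.any? λ (m : Fin n) → ∃? (enum-Vec (enum-Fin n) (suc (suc (toℕ m)))) λ vs → isCycle? M (lookup vs)))
  where
  to : (∃ λ (m : Fin n) → ∃ λ (vs : Vec (Fin n) (suc (suc (toℕ m)))) → IsCycle M (lookup vs)) → DirectedCycle M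
  to (m , vs , cycle) = toℕ m , lookup vs , cycle
  from : DirectedCycle M → ∃ λ (m : Fin n) → ∃ λ (vs : Vec (Fin n) (suc (suc (toℕ m)))) → IsCycle M (lookup vs)
  from (m , v , cycle@(injective , _)) = Fin.fromℕ< m<n , shorten (Fin.toℕ-fromℕ< m<n)
    where
    m<n : m ℕ.< n
    m<n = ℕ.≤-trans (ℕ.n≤1+n _) (Fin.injective⇒≤ injective)
    shorten : ∀ {m′} → m′ ≡ m → ∃ λ (vs : Vec (Fin n) (suc (suc m′))) → IsCycle M (lookup vs)
    shorten refl = Vec.tabulate v , IsCycle-cong M (λ i → ≡.sym (Vec.lookup∘tabulate v i)) cycle

isOrientationOf? : (G : Graph n) → ∀ U M → Dec (IsOrientationOf G U M)
isOrientationOf? G U M =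
  (Fin.all? λ u → Fin.all? λ v → arc? M u v →-dec ((u ∈? U) ×-dec (v ∈? U) ×-dec edge? G u v)) ×-dec
  (Fin.all? λ u → Fin.all? λ v → (u ∈? U) →-dec ((v ∈? U) →-dec (edge? G u v →-dec
    ((arc? M u v ×-dec ¬? (arc? M v u)) ⊎-dec (arc? M v u ×-dec ¬? (arc? M u v))))))

isSource? : ∀ U (M : Orient n) s → Dec (IsSource U M s)
isSource? U M s = (s ∈? U) ×-dec Fin.all? λ u → ¬? (arc? M u s)

isMin? : ∀ (U : Subset n) s → Dec (IsMin U s)
isMin? U s = (s ∈? U) ×-dec Fin.all? λ u → (u ∈? U) →-dec (s Fin.≤? u)

IsAcyclicOrientation : Graph n → Subset n → Orient n → Set
IsAcyclicOrientation G U M = IsOrientationOf G U M × Acyclic M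

abstract
  isAcyclicOrientation? : (G : Graph n) → ∀ U M → Dec (IsAcyclicOrientation G U M)
  isAcyclicOrientation? G U M = isOrientationOf? G U M ×-dec acyclic? M

RootedAtMin : Subset n → Orient n → Set
RootedAtMin U M = (∃ λ v → v ∈ U) × (∀ s → IsSource U M s ⇔ IsMin U s)

abstract
  rootedAtMin? : ∀ (U : Subset n) M → Dec (RootedAtMin U M)
  rootedAtMin? U M = nonempty? U ×-dec Fin.all? λ s →
    Dec.map′ (λ (f , g) → mk⇔ f g) (λ e → Equivalence.to e , Equivalence.from e)
      ((isSource? U M s →-dec isMin? U s) ×-dec (isMin? U s →-dec isSource? U M s))

Independent : Graph n → Subset n → Set
Independent G U = ∀ u v → u ∈ U → v ∈ U → ¬ Edge G u v

abstract
  independent? : (G : Graph n) → ∀ U → Dec (Independent G U)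
  independent? G U = Fin.all? λ u → Fin.all? λ v → (u ∈? U) →-dec ((v ∈? U) →-dec ¬? (edge? G u v))

-- Sources of acyclic orientations

module _ {G : Graph n} {U : Subset n} {M : Orient n} (orientation : IsAcyclicOrientation G U M) where
  private
    no-loop : ∀ u → ¬ Arc M u u
    no-loop u loop with trans (≡.sym (irrefl G u)) (proj₂ (proj₂ (proj₁ (proj₁ orientation) u u loop)))
    ... | ()

    record Path (k : ℕ) : Set where
      field
        vertex    : Fin (suc k) → Fin n
        injective : Injective _≡_ _≡_ vertex
        arcs      : ∀ i → Arc M (vertex (inject₁ i)) (vertex (suc i))
        start∈U   : vertex zero ∈ U
    open Path

    -- Such an arc closes the initial segment ending at vertex i into a directed cycle. A
    -- `DirectedCycle` has at least two vertices, so i = 0 is excluded separately, by irreflexivity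
    -- of G.
    no-chord : ∀ {k} (p : Path k) i → ¬ Arc M (vertex p i) (vertex p zero)
    no-chord p zero    = no-loop _
    no-chord {suc k} p (suc i) chord = proj₂ orientation (toℕ i , v ,
      (λ eq → Fin.inject≤-injective i<k i<k _ _ (injective p eq)) ,
      (λ j → subst (λ l → Arc M (vertex p l) (v (suc j))) (inject-arc j) (arcs p (inject≤ j (ℕ.s≤s⁻¹ i<k)))) ,
      subst (λ l → Arc M (vertex p l) (vertex p zero)) last-vertex chord)
      where
      i<k : suc (suc (toℕ i)) ℕ.≤ suc (suc k)
      i<k = ℕ.s≤s (Fin.toℕ<n i)
      v : Fin (suc (suc (toℕ i))) → Fin n
      v j = vertex p (inject≤ j i<k)
      inject-arc : ∀ j → inject₁ (inject≤ j (ℕ.s≤s⁻¹ i<k)) ≡ inject≤ (inject₁ j) i<k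
      inject-arc j = Fin.toℕ-injective (trans (Fin.toℕ-inject₁ _) (trans (Fin.toℕ-inject≤ j _)
        (≡.sym (trans (Fin.toℕ-inject≤ (inject₁ j) _) (Fin.toℕ-inject₁ j)))))
      last-vertex : suc i ≡ inject≤ (fromℕ (suc (toℕ i))) i<k
      last-vertex = Fin.toℕ-injective (≡.sym (trans (Fin.toℕ-inject≤ (fromℕ (suc (toℕ i))) i<k) (Fin.toℕ-fromℕ _)))

    prepend : ∀ {k} (p : Path k) {u} → Arc M u (vertex p zero) → Path (suc k)
    prepend p {u} arc = record
      { vertex    = u Fun.∷ vertex p
      ; injective = λ {i} {j} → extended-injective i j
      ; arcs      = λ where
          zero    → arc
          (suc i) → arcs p i
      ; start∈U   = proj₁ (proj₁ (proj₁ orientation) _ _ arc)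
      }
      where
      extended-injective : ∀ i j → (u Fun.∷ vertex p) i ≡ (u Fun.∷ vertex p) j → i ≡ j
      extended-injective zero    zero    _  = refl
      -- If u were already on the path, the new arc would be a chord back to its start.
      extended-injective zero    (suc j) eq = contradiction (subst (λ x → Arc M x (vertex p zero)) eq arc) (no-chord p j)
      extended-injective (suc i) zero    eq = contradiction (subst (λ x → Arc M x (vertex p zero)) (≡.sym eq) arc) (no-chord p i)
      extended-injective (suc i) (suc j) eq = cong suc (injective p eq)

  -- Otherwise arcs could be followed backwards forever, without ever revisiting a vertex.
  source-exists : Nonempty U → ∃ λ s → IsSource U M s
  source-exists (u , u∈U) with Fin.any? (isSource? U M)
  ... | yes source    = source
  ... | no  no-source = ⊥-elim (Fin.<⇒notInjective (ℕ.n<1+n n) (injective (path n)))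
    where
    predecessor : ∀ v → v ∈ U → ∃ λ w → Arc M w v
    predecessor v v∈U with Fin.any? (λ w → arc? M w v)
    ... | yes p = p
    ... | no ¬p = ⊥-elim (no-source (v , v∈U , λ w arc → ¬p (w , arc)))
    path : ∀ k → Path k
    path zero    = record { vertex = λ _ → u ; injective = λ { {zero} {zero} _ → refl } ; arcs = λ () ; start∈U = u∈U }
    path (suc k) = prepend (path k) (proj₂ (predecessor _ (start∈U (path k))))

does⇒ : {X : Set} (d : Dec X) → does d ≡ true → X
does⇒ (yes x) _ = x

abstract
  sources : Subset n → Orient n → Subset n
  sources U M = Vec.tabulate λ s → does (isSource? U M s)

  ∈-sources⁺ : ∀ U (M : Orient n) {s} → IsSource U M s → s ∈ sources U M
  ∈-sources⁺ U M {s} source = Vec.lookup⇒[]= s _ (trans (Vec.lookup∘tabulate _ s) (dec-true (isSource? U M s) source))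

  ∈-sources⁻ : ∀ U (M : Orient n) {s} → s ∈ sources U M → IsSource U M s
  ∈-sources⁻ U M {s} s∈ = does⇒ (isSource? U M s)
    (trans (≡.sym (Vec.lookup∘tabulate (λ s → does (isSource? U M s)) s)) (Vec.[]=⇒lookup s∈))

IsMin-suc : ∀ {V : Subset n} {b s} → IsMin (b ∷ V) (suc s) → IsMin V s
IsMin-suc (there s∈V , least) = s∈V , λ u u∈V → ℕ.s≤s⁻¹ (least (suc u) (there u∈V))

∈-dropMin⊎IsMin : ∀ (V : Subset n) {u} → u ∈ V → u ∈ dropMin V ⊎ IsMin V u
∈-dropMin⊎IsMin (true ∷ V)  here        = inj₂ (here , λ _ _ → ℕ.z≤n)
∈-dropMin⊎IsMin (true ∷ V)  (there u∈V) = inj₁ (there u∈V)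
∈-dropMin⊎IsMin (false ∷ V) (there u∈V) = Sum.map there
  (λ (u∈V , least) → there u∈V , λ { (suc v) (there v∈V) → ℕ.s≤s (least v v∈V) }) (∈-dropMin⊎IsMin V u∈V)

∈-dropMin⇒¬IsMin : ∀ (V : Subset n) {u} → u ∈ dropMin V → ¬ IsMin V u
∈-dropMin⇒¬IsMin (true ∷ V)  (there u∈) (_ , least) with () ← least zero here
∈-dropMin⇒¬IsMin (false ∷ V) (there u∈) isMin = ∈-dropMin⇒¬IsMin V u∈ (IsMin-suc isMin)

dropMin-⊆ : ∀ (V : Subset n) → dropMin V ⊆ V
dropMin-⊆ (true ∷ V)  (there u∈) = there u∈
dropMin-⊆ (false ∷ V) (there u∈) = there (dropMin-⊆ V u∈)

IsMin-unique : ∀ {V : Subset n} {s t} → IsMin V s → IsMin V t → s ≡ t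
IsMin-unique (s∈V , s-least) (t∈V , t-least) = Fin.toℕ-injective (ℕ.≤-antisym (s-least _ t∈V) (t-least _ s∈V))

module _ {V : Subset n} {M : Orient n} where
  rooted⇒ : RootedAtMin V M → ¬ Nonempty (dropMin V ∩ sources V M)
  rooted⇒ (_ , sources⇔min) (s , s∈) =
    let s∈dropMin , s∈sources = x∈p∩q⁻ (dropMin V) (sources V M) s∈
    in ∈-dropMin⇒¬IsMin V s∈dropMin (Equivalence.to (sources⇔min s) (∈-sources⁻ V M s∈sources))

  -- Absence of other sources only shows that every source is the minimum; that the minimum is a
  -- source follows because some source exists.
  rooted⇐ : ∀ {G} → IsAcyclicOrientation G V M → Nonempty V →
            ¬ Nonempty (dropMin V ∩ sources V M) → RootedAtMin V M
  rooted⇐ {G} orientation V≢∅ none = V≢∅ , λ s → mk⇔ source⇒min λ min →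
    let s′ , source = source-exists {G = G} {V} {M} orientation V≢∅
    in subst (IsSource V M) (IsMin-unique (source⇒min source) min) source
    where
    source⇒min : ∀ {s} → IsSource V M s → IsMin V s
    source⇒min source@(s∈V , _) with ∈-dropMin⊎IsMin V s∈V
    ... | inj₁ s∈dropMin = ⊥-elim (none (_ , x∈p∩q⁺ (s∈dropMin , ∈-sources⁺ V M source)))
    ... | inj₂ min       = min

-- Making an independent set into sources

fromRelation : {R : Fin n → Fin n → Set} → (∀ u v → Dec (R u v)) → Orient n
fromRelation R? = Vec.tabulate λ u → Vec.tabulate λ v → does (R? u v)

module _ {R : Fin n → Fin n → Set} (R? : ∀ u v → Dec (R u v)) where
  private
    lookup-fromRelation : ∀ u v → lookup (lookup (fromRelation R?) u) v ≡ does (R? u v)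
    lookup-fromRelation u v = trans (cong (λ row → lookup row v) (Vec.lookup∘tabulate _ u)) (Vec.lookup∘tabulate _ v)

  Arc-fromRelation⁺ : ∀ {u v} → R u v → Arc (fromRelation R?) u v
  Arc-fromRelation⁺ {u} {v} r = trans (lookup-fromRelation u v) (dec-true (R? u v) r)

  Arc-fromRelation⁻ : ∀ {u v} → Arc (fromRelation R?) u v → R u v
  Arc-fromRelation⁻ {u} {v} arc = does⇒ (R? u v) (trans (≡.sym (lookup-fromRelation u v)) arc)

Orient-ext : {M N : Orient n} → (∀ u v → Arc M u v → Arc N u v) → (∀ u v → Arc N u v → Arc M u v) → M ≡ N
Orient-ext {M = M} {N} M⊆N N⊆M = Vec-ext λ u → Vec-ext λ v → Bool-ext (M⊆N u v) (N⊆M u v)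
  where
  Vec-ext : ∀ {A : Set} {m} {xs ys : Vec A m} → lookup xs ≗ lookup ys → xs ≡ ys
  Vec-ext {xs = xs} {ys} eq = trans (≡.sym (Vec.tabulate∘lookup xs)) (trans (Vec.tabulate-cong eq) (Vec.tabulate∘lookup ys))
  Bool-ext : ∀ {a b} → (a ≡ true → b ≡ true) → (b ≡ true → a ≡ true) → a ≡ b
  Bool-ext {false} {false} _ _ = refl
  Bool-ext {true}  {b}     f _ = ≡.sym (f refl)
  Bool-ext {false} {true}  _ g = g refl

-- Acyclic orientations of G[U ─ W] correspond to acyclic orientations of G[U]
-- in which all vertices of W are sources, when W is independent.
module _ (G : Graph n) {U W : Subset n} (W⊆U : W ⊆ U) where
  WithSources : Orient n → Set
  WithSources M = IsAcyclicOrientation G U M × W ⊆ sources U M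

  withSources? : ∀ M → Dec (WithSources M)
  withSources? M = isAcyclicOrientation? G U M ×-dec (W ⊆? sources U M)

  private
    no-arc-into-W : ∀ M → WithSources M → ∀ {u w} → w ∈ W → ¬ Arc M u w
    no-arc-into-W M (_ , W-sources) w∈W = proj₂ (∈-sources⁻ U M (W-sources w∈W)) _

    -- Only tails are tested: when W consists of sources, no arc has its head in W.
    Remaining : Orient n → Fin n → Fin n → Set
    Remaining M u v = Arc M u v × ¬ u ∈ W
    remaining? : ∀ M u v → Dec (Remaining M u v)
    remaining? M u v = arc? M u v ×-dec ¬? (u ∈? W)

    -- Vertices of W can be sources only if every edge at W leaves W, so the added arcs are forced.
    Extended : Orient n → Fin n → Fin n → Set
    Extended M u v = Arc M u v ⊎ (u ∈ W × v ∈ U × Edge G u v)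
    extended? : ∀ M u v → Dec (Extended M u v)
    extended? M u v = arc? M u v ⊎-dec ((u ∈? W) ×-dec (v ∈? U) ×-dec edge? G u v)

    abstract
      restrict extend : Orient n → Orient n
      restrict M = fromRelation (remaining? M)
      extend M   = fromRelation (extended? M)

      restrict⁻ : ∀ {M u v} → Arc (restrict M) u v → Remaining M u v
      restrict⁻ {M} = Arc-fromRelation⁻ (remaining? M)
      restrict⁺ : ∀ {M u v} → Remaining M u v → Arc (restrict M) u v
      restrict⁺ {M} = Arc-fromRelation⁺ (remaining? M)
      extend⁻ : ∀ {M u v} → Arc (extend M) u v → Extended M u v
      extend⁻ {M} = Arc-fromRelation⁻ (extended? M)
      extend⁺ : ∀ {M u v} → Extended M u v → Arc (extend M) u v
      extend⁺ {M} = Arc-fromRelation⁺ (extended? M)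

  -- However an edge inside W is oriented, its head is not a source.
  withSources⇒independent : ∀ M → WithSources M → Independent G W
  withSources⇒independent M M!@(((_ , oriented) , _) , _) u v u∈W v∈W edge
    with oriented u v (W⊆U u∈W) (W⊆U v∈W) edge
  ... | inj₁ (arc , _) = no-arc-into-W M M! v∈W arc
  ... | inj₂ (arc , _) = no-arc-into-W M M! u∈W arc

  private
    restrict-acyclic : ∀ M → WithSources M → IsAcyclicOrientation G (U ─ W) (restrict M)
    restrict-acyclic M M!@(((arcs , oriented) , acyclic) , _) =
      ( (λ u v arc → let arc′ , u∉W = restrict⁻ arc
                         u∈U , v∈U , edge = arcs u v arc′
                     in x∈p∧x∉q⇒x∈p─q u∈U u∉W , x∈p∧x∉q⇒x∈p─q v∈U (λ v∈W → no-arc-into-W M M! v∈W arc′) , edge)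
      , (λ u v u∈ v∈ edge → Sum.map
          (λ (arc , ¬arc) → restrict⁺ (arc , x∈p─q⇒x∉q {p = U} u∈) , ¬arc ∘ proj₁ ∘ restrict⁻)
          (λ (arc , ¬arc) → restrict⁺ (arc , x∈p─q⇒x∉q {p = U} v∈) , ¬arc ∘ proj₁ ∘ restrict⁻)
          (oriented u v (p─q⊆p U W u∈) (p─q⊆p U W v∈) edge))) ,
      Arc-mono-Acyclic {M = restrict M} {M} (λ u v → proj₁ ∘ restrict⁻) acyclic

    extend-restrict : ∀ M → WithSources M → extend (restrict M) ≡ M
    extend-restrict M M!@(((arcs , oriented) , _) , _) = Orient-ext to from
      where
      to : ∀ u v → Arc (extend (restrict M)) u v → Arc M u v
      to u v arc with extend⁻ arc
      ... | inj₁ arc′ = proj₁ (restrict⁻ arc′)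
      ... | inj₂ (u∈W , v∈U , edge) with oriented u v (W⊆U u∈W) v∈U edge
      ...   | inj₁ (arc′ , _) = arc′
      ...   | inj₂ (arc′ , _) = ⊥-elim (no-arc-into-W M M! u∈W arc′)
      from : ∀ u v → Arc M u v → Arc (extend (restrict M)) u v
      from u v arc with u ∈? W
      ... | yes u∈W = extend⁺ (inj₂ (u∈W , proj₂ (arcs u v arc)))
      ... | no  u∉W = extend⁺ (inj₁ (restrict⁺ (arc , u∉W)))

    restrict-extend : ∀ M → IsAcyclicOrientation G (U ─ W) M → restrict (extend M) ≡ M
    restrict-extend M ((arcs , _) , _) = Orient-ext to from
      where
      to : ∀ u v → Arc (restrict (extend M)) u v → Arc M u v
      to u v arc with restrict⁻ arc
      ... | arc′ , u∉W with extend⁻ arc′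
      ...   | inj₁ arc″        = arc″
      ...   | inj₂ (u∈W , _)   = contradiction u∈W u∉W
      from : ∀ u v → Arc M u v → Arc (restrict (extend M)) u v
      from u v arc = restrict⁺ (extend⁺ (inj₁ arc) , x∈p─q⇒x∉q {p = U} (proj₁ (arcs u v arc)))

    module _ (W-independent : Independent G W) M (M! : IsAcyclicOrientation G (U ─ W) M) where
      arcs     = proj₁ (proj₁ M!)
      oriented = proj₂ (proj₁ M!)

      target∉W : ∀ {u v} → Arc (extend M) u v → ¬ v ∈ W
      target∉W {u} {v} arc v∈W with extend⁻ arc
      ... | inj₁ arc′             = x∈p─q⇒x∉q {p = U} (proj₁ (proj₂ (arcs u v arc′))) v∈W
      ... | inj₂ (u∈W , _ , edge) = W-independent u v u∈W v∈W edge

      -- Every vertex of a cycle has an incoming arc, so a cycle avoids W.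
      extend-cycle : DirectedCycle (extend M) → DirectedCycle M
      extend-cycle (m , v , injective , cycle-arcs , closing) =
        m , v , injective , (λ k → old-arc (avoids-W _) (cycle-arcs k)) , old-arc (avoids-W _) closing
        where
        avoids-W : ∀ k → ¬ v k ∈ W
        avoids-W zero    = target∉W closing
        avoids-W (suc k) = target∉W (cycle-arcs k)
        old-arc : ∀ {a b} → ¬ a ∈ W → Arc (extend M) a b → Arc M a b
        old-arc a∉W arc with extend⁻ arc
        ... | inj₁ arc′      = arc′
        ... | inj₂ (a∈W , _) = contradiction a∈W a∉W

      extend-withSources : WithSources (extend M)
      extend-withSources = ((arcs′ , oriented′) , proj₂ M! ∘ extend-cycle) ,
        λ w∈W → ∈-sources⁺ U (extend M) (W⊆U w∈W , λ u arc → target∉W arc w∈W)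
        where
        arcs′ : ∀ u v → Arc (extend M) u v → u ∈ U × v ∈ U × Edge G u v
        arcs′ u v arc with extend⁻ arc
        ... | inj₂ (u∈W , v∈U , edge) = W⊆U u∈W , v∈U , edge
        ... | inj₁ arc′ = let u∈ , v∈ , edge = arcs u v arc′ in p─q⊆p U W u∈ , p─q⊆p U W v∈ , edge

        not-new : ∀ {u v} → ¬ u ∈ W → ¬ Arc M u v → ¬ Arc (extend M) u v
        not-new u∉W ¬arc arc with extend⁻ arc
        ... | inj₁ arc′      = ¬arc arc′
        ... | inj₂ (u∈W , _) = u∉W u∈W

        oriented′ : ∀ u v → u ∈ U → v ∈ U → Edge G u v →
          (Arc (extend M) u v × ¬ Arc (extend M) v u) ⊎ (Arc (extend M) v u × ¬ Arc (extend M) u v)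
        oriented′ u v u∈U v∈U edge with u ∈? W | v ∈? W
        ... | yes u∈W | _       = inj₁ (extend⁺ (inj₂ (u∈W , v∈U , edge)) , λ arc → target∉W arc u∈W)
        ... | no _    | yes v∈W = inj₂ (extend⁺ (inj₂ (v∈W , u∈U , trans (sym G v u) edge)) , λ arc → target∉W arc v∈W)
        ... | no u∉W  | no v∉W  = Sum.map
          (λ (arc , ¬arc) → extend⁺ (inj₁ arc) , not-new v∉W ¬arc)
          (λ (arc , ¬arc) → extend⁺ (inj₁ arc) , not-new u∉W ¬arc)
          (oriented u v (x∈p∧x∉q⇒x∈p─q u∈U u∉W) (x∈p∧x∉q⇒x∈p─q v∈U v∉W) edge)

  -- For independent W, `restrict` and `extend` are inverse to each other; for other W both sides
  -- vanish.
  #withSources : ∑ₑ (enum-Orient n) (λ M → ⟦ withSources? M ⟧) ≡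
                 ⟦ independent? G W ⟧ * #orientations (isAcyclicOrientation? G) (U ─ W)
  #withSources = by-cases (independent? G W)
    where
    remainder = #orientations (isAcyclicOrientation? G) (U ─ W)
    by-cases : (d : Dec (Independent G W)) → ∑ₑ (enum-Orient n) (λ M → ⟦ withSources? M ⟧) ≡ ⟦ d ⟧ * remainder
    by-cases (yes W-independent) = trans
      (∑-bijection (enum-Orient n) (enum-Orient n) withSources? (isAcyclicOrientation? G (U ─ W)) restrict extend
        (restrict-acyclic _) (extend-withSources W-independent _) (extend-restrict _) (restrict-extend _))
      (≡.sym (ℤ.*-identityˡ remainder))
    by-cases (no ¬independent) = trans
      (∑-cong (Enumeration.elements (enum-Orient n)) λ M → ⟦⟧-no (withSources? M) (¬independent ∘ withSources⇒independent M))
      (trans (∑-zero (Enumeration.elements (enum-Orient n))) (≡.sym (ℤ.*-zeroˡ remainder)))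

-- Alternating sums over subsets

⟦⟧-*-zero : ∀ {X : Set} (d : Dec X) {z} → (X → z ≡ 0ℤ) → ⟦ d ⟧ * z ≡ 0ℤ
⟦⟧-*-zero (yes x) {z} z≡0 = trans (ℤ.*-identityˡ z) (z≡0 x)
⟦⟧-*-zero (no _)  {z} _   = ℤ.*-zeroˡ z

-- Only W ⊆ K ∩ S contribute, and toggling an element of K ∩ S flips the sign, so all terms cancel
-- unless K ∩ S is empty.
∑⊆-sgn : ∀ (K S : Subset n) → ∑⊆ K (λ W → sgn W * ⟦ W ⊆? S ⟧) ≡ δ (K ∩ S)
∑⊆-sgn []          []          = refl
∑⊆-sgn (false ∷ K) (s ∷ S)     = ∑⊆-sgn K S
∑⊆-sgn (true ∷ K)  (false ∷ S) = trans
  (cong₂ _+_ (∑⊆-sgn K S) (trans (∑⊆-cong K λ W → ℤ.*-zeroʳ (- sgn W)) (∑⊆-zero K))) (ℤ.+-identityʳ _)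
∑⊆-sgn (true ∷ K)  (true ∷ S)  = trans
  (cong (λ z → kept + z) (trans (∑⊆-cong K λ W → negate (sgn W) ⟦ W ⊆? S ⟧) (∑⊆-* K -1ℤ λ W → sgn W * ⟦ W ⊆? S ⟧)))
  (cancel kept)
  where
  kept = ∑⊆ K (λ W → sgn W * ⟦ W ⊆? S ⟧)
  negate : ∀ s x → - s * x ≡ -1ℤ * (s * x)
  negate = solve-∀
  cancel : ∀ z → z + -1ℤ * z ≡ 0ℤ
  cancel = solve-∀

-- The sizes subtract, and a sign is its own inverse.
sgn-─ : ∀ (U W : Subset n) → W ⊆ U → sgn (U ─ W) ≡ sgn U * sgn W
sgn-─ []          []          _   = refl
sgn-─ (false ∷ U) (false ∷ W) W⊆U = sgn-─ U W (drop-∷-⊆ W⊆U)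
sgn-─ (true ∷ U)  (false ∷ W) W⊆U = trans (cong -_ (sgn-─ U W (drop-∷-⊆ W⊆U))) (ℤ.neg-distribˡ-* (sgn U) (sgn W))
sgn-─ (true ∷ U)  (true ∷ W)  W⊆U = trans (sgn-─ U W (drop-∷-⊆ W⊆U)) (negate² (sgn U) (sgn W))
  where
  negate² : ∀ s t → s * t ≡ - s * - t
  negate² = solve-∀
sgn-─ (false ∷ U) (true ∷ W)  W⊆U with () ← W⊆U here

sgn-∅ : sgn (∅ {n}) ≡ 1ℤ
sgn-∅ {zero}  = refl
sgn-∅ {suc n} = sgn-∅ {n}

δ-∅ : δ (∅ {n}) ≡ 1ℤ
δ-∅ {zero}  = refl
δ-∅ {suc n} = δ-∅ {n}

⋆-∅ : ∀ (f g : SetFunction n) → (f ⋆ g) ∅ ≡ f ∅ * g ∅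
⋆-∅ {zero}  f g = refl
⋆-∅ {suc n} f g = ⋆-∅ (f ₀) (g ₀)

∩-nonempty : ∀ {V : Subset n} {M} → (∃ λ s → IsSource V M s) → Nonempty (V ∩ sources V M)
∩-nonempty {V = V} {M} (s , source) = s , x∈p∩q⁺ (proj₁ source , ∈-sources⁺ V M source)

-- The counting functions of a graph

module Counts (G : Graph n) where
  open Enumeration
  private orients = elements (enum-Orient n)

  rootedOrientation? : ∀ U M → Dec (IsAcyclicOrientation G U M × RootedAtMin U M)
  rootedOrientation? U M = isAcyclicOrientation? G U M ×-dec rootedAtMin? U M

  #independent #acyclic #rooted : SetFunction n
  #independent W = ⟦ independent? G W ⟧
  #acyclic       = #orientations (isAcyclicOrientation? G)
  #rooted        = #orientations rootedOrientation?

  -- Inclusion–exclusion over the sets W of sources lying in K.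
  ∑⊆-sources : ∀ {K U} → K ⊆ U → ∑⊆ K (λ W → #independent W * signed #acyclic (U ─ W)) ≡
    sgn U * ∑ orients λ M → ⟦ isAcyclicOrientation? G U M ⟧ * δ (K ∩ sources U M)
  ∑⊆-sources {K} {U} K⊆U = begin
    ∑⊆ K (λ W → #independent W * (sgn (U ─ W) * #acyclic (U ─ W)))
      ≡⟨ ∑⊆-cong-⊆ K term ⟩
    ∑⊆ K (λ W → sgn U * ∑ orients λ M → acyclic M * (sgn W * ⟦ W ⊆? sources U M ⟧))
      ≡⟨ ∑⊆-* K (sgn U) _ ⟩
    sgn U * ∑⊆ K (λ W → ∑ orients λ M → acyclic M * (sgn W * ⟦ W ⊆? sources U M ⟧))
      ≡⟨ cong (sgn U *_) (∑⊆-∑-swap K orients _) ⟩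
    sgn U * ∑ orients (λ M → ∑⊆ K λ W → acyclic M * (sgn W * ⟦ W ⊆? sources U M ⟧))
      ≡⟨ cong (sgn U *_) (∑-cong orients λ M → trans (∑⊆-* K (acyclic M) λ W → sgn W * ⟦ W ⊆? sources U M ⟧)
           (cong (acyclic M *_) (∑⊆-sgn K (sources U M)))) ⟩
    sgn U * ∑ orients (λ M → acyclic M * δ (K ∩ sources U M)) ∎
    where
    open ≡-Reasoning
    acyclic : Orient n → ℤ
    acyclic M = ⟦ isAcyclicOrientation? G U M ⟧

    rearrange : ∀ i s t a → i * (s * t * a) ≡ s * (t * (i * a))
    rearrange = solve-∀

    left-commute : ∀ s x y → s * (x * y) ≡ x * (s * y)
    left-commute = solve-∀

    term : ∀ W → W ⊆ K → #independent W * (sgn (U ─ W) * #acyclic (U ─ W)) ≡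
      sgn U * ∑ orients λ M → acyclic M * (sgn W * ⟦ W ⊆? sources U M ⟧)
    term W W⊆K = begin
      #independent W * (sgn (U ─ W) * #acyclic (U ─ W))
        ≡⟨ cong (λ s → #independent W * (s * #acyclic (U ─ W))) (sgn-─ U W W⊆U) ⟩
      #independent W * (sgn U * sgn W * #acyclic (U ─ W))
        ≡⟨ rearrange (#independent W) (sgn U) (sgn W) (#acyclic (U ─ W)) ⟩
      sgn U * (sgn W * (#independent W * #acyclic (U ─ W)))
        ≡⟨ cong (λ z → sgn U * (sgn W * z)) (#withSources G W⊆U) ⟨
      sgn U * (sgn W * ∑ orients (λ M → ⟦ withSources? G W⊆U M ⟧))
        ≡⟨ cong (sgn U *_) (≡.sym (∑-* orients (sgn W) _)) ⟩
      sgn U * ∑ orients (λ M → sgn W * ⟦ withSources? G W⊆U M ⟧)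
        ≡⟨ cong (sgn U *_) (∑-cong orients λ M → trans
             (cong (sgn W *_) (⟦⟧-× (isAcyclicOrientation? G U M) (W ⊆? sources U M)))
             (left-commute (sgn W) (acyclic M) ⟦ W ⊆? sources U M ⟧)) ⟩
      sgn U * ∑ orients (λ M → acyclic M * (sgn W * ⟦ W ⊆? sources U M ⟧)) ∎
      where
      W⊆U : W ⊆ U
      W⊆U = K⊆U ∘ W⊆K

  #independent-∅ : #independent ∅ ≡ 1ℤ
  #independent-∅ = ⟦⟧-yes (independent? G ∅) λ u v u∈∅ → contradiction u∈∅ ∉⊥

  -- `IsOrientationOf` forbids arcs outside the set, so the matrix without arcs is the only
  -- orientation of ∅.
  #acyclic-∅ : #acyclic ∅ ≡ 1ℤ
  #acyclic-∅ = ∑-bijection {Q = λ _ → Unit.⊤} (enum-Orient n) (enum-Fin 1) (isAcyclicOrientation? G ∅) (λ _ → yes Unit.tt)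
    (λ _ → zero) (λ _ → empty) (λ _ → Unit.tt) (λ _ → empty-acyclic)
    (λ ((arcs , _) , _) → Orient-ext (λ u v arc → ⊥-elim (empty-arcless arc))
      (λ u v arc → contradiction (proj₁ (arcs u v arc)) ∉⊥))
    (λ { {zero} _ → refl })
    where
    never? : ∀ (u v : Fin n) → Dec Empty.⊥
    never? _ _ = no λ ()
    empty : Orient n
    empty = fromRelation never?
    empty-arcless : ∀ {u v} → ¬ Arc empty u v
    empty-arcless = Arc-fromRelation⁻ never?
    empty-acyclic : IsAcyclicOrientation G ∅ empty
    empty-acyclic = ((λ u v arc → ⊥-elim (empty-arcless arc)) , λ u v u∈∅ → contradiction u∈∅ ∉⊥) ,
      λ (m , v , _ , _ , closing) → empty-arcless closing

  #rooted-∅ : #rooted ∅ ≡ 0ℤ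
  #rooted-∅ = trans (∑-cong orients λ M → ⟦⟧-no (rootedOrientation? ∅ M) λ (_ , (v , v∈∅) , _) → ∉⊥ v∈∅) (∑-zero orients)

  -- With K = V, only acyclic orientations without any source could survive in `∑⊆-sources`, and for
  -- V ≠ ∅ there are none.
  independent⋆acyclic : #independent ⋆ signed #acyclic ≗ δ
  independent⋆acyclic V with nonempty? V
  ... | no V≡∅ = subst (λ U → (#independent ⋆ signed #acyclic) U ≡ δ U) (≡.sym (Empty-unique V≡∅))
    (trans (⋆-∅ #independent (signed #acyclic))
      (trans (cong₂ _*_ #independent-∅ (cong₂ _*_ (sgn-∅ {n}) #acyclic-∅)) (≡.sym (δ-∅ {n}))))
  ... | yes V≢∅ = trans (∑⊆-sources {V} id) (trans (cong (sgn V *_) (trans (∑-cong orients vanishing) (∑-zero orients)))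
    (trans (ℤ.*-zeroʳ (sgn V)) (≡.sym (δ-nonempty V V≢∅))))
    where
    δ-nonempty : ∀ (U : Subset n) → Nonempty U → δ U ≡ 0ℤ
    δ-nonempty U U≢∅ = trans (δ-⟦⟧ U) (⟦⟧-no (¬? (nonempty? U)) λ U≡∅ → U≡∅ U≢∅)
    vanishing : ∀ M → ⟦ isAcyclicOrientation? G V M ⟧ * δ (V ∩ sources V M) ≡ 0ℤ
    vanishing M = ⟦⟧-*-zero (isAcyclicOrientation? G V M) λ M! →
      δ-nonempty (V ∩ sources V M) (∩-nonempty (source-exists {G = G} {V} {M} M! V≢∅))

  -- With K = `dropMin V`, the survivors are the acyclic orientations with no source other than the
  -- minimum.
  rooted-log : ∀ V → Nonempty V →
    -1ℤ * signed #rooted V ≡ - ∑⊆ (dropMin V) λ W → #independent W * signed #acyclic (V ─ W)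
  rooted-log V V≢∅ = trans (ℤ.-1*i≡-i _) (cong -_ (≡.sym (trans (∑⊆-sources (dropMin-⊆ V))
    (cong (sgn V *_) (∑-cong orients rooted)))))
    where
    rooted : ∀ M → ⟦ isAcyclicOrientation? G V M ⟧ * δ (dropMin V ∩ sources V M) ≡ ⟦ rootedOrientation? V M ⟧
    rooted M = trans (cong (⟦ isAcyclicOrientation? G V M ⟧ *_) (δ-⟦⟧ (dropMin V ∩ sources V M))) (trans
      (≡.sym (⟦⟧-× (isAcyclicOrientation? G V M) no-other-source?))
      (⟦⟧-⇔ (isAcyclicOrientation? G V M ×-dec no-other-source?) (rootedOrientation? V M)
        (λ (M! , none) → M! , rooted⇐ {G = G} M! V≢∅ none) (λ (M! , root) → M! , rooted⇒ root)))
      where no-other-source? = ¬? (nonempty? (dropMin V ∩ sources V M))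

  -- The sign (-1)^(|V|-1) is written as -1 times (-1)^|V|, which avoids a negative exponent at ∅.
  signedRooted : SetFunction n
  signedRooted V = -1ℤ * signed #rooted V

  logarithmic : Logarithmic #independent (signed #acyclic) signedRooted
  logarithmic = record
    { I∅      = #independent-∅
    ; A∅      = cong₂ _*_ (sgn-∅ {n}) #acyclic-∅
    ; inverse = independent⋆acyclic
    ; log     = rooted-log
    }

  signedRooted-∅ : signedRooted ∅ ≡ 0ℤ
  signedRooted-∅ = cong (-1ℤ *_) (trans (cong (sgn (∅ {n}) *_) #rooted-∅) (ℤ.*-zeroʳ (sgn (∅ {n}))))

  proper? : ∀ {q} (c : Vec (Fin q) n) → Dec (Proper G c)
  proper? c = Fin.all? λ u → Fin.all? λ v → edge? G u v →-dec ¬? (lookup c u Fin.≟ lookup c v)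

  -- A colouring is proper exactly when all its colour classes are independent, so proper colourings
  -- are ordered partitions into q independent sets, empty ones allowed.
  #colourings : ∀ q {m} → HasCard (ProperColoring G q) m → + m ≡ (#independent ⋆^ q) ⊤
  #colourings q {m} m-card = begin
    + m
      ≡⟨ cong +_ (HasCard-unique m-card (card-↔ colours proper?) (mk↔ₛ′ id id (λ _ → refl) (λ _ → refl))) ⟩
    + card colours proper?
      ≡⟨ +card colours proper? ⟩
    ∑ₑ colours (λ c → ⟦ proper? c ⟧)
      ≡⟨ (∑-cong (elements colours) λ c → trans
           (⟦⟧-⇔ (proper? c) (Fin.all? λ k → independent? G (colourClass k c)) (classes⁺ c) (classes⁻ c))
           (⟦⟧-∀ λ k → independent? G (colourClass k c))) ⟩
    ∑ₑ colours (λ c → ∏ λ k → #independent (colourClass k c))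
      ≡⟨ ∑-colourings n (λ _ → #independent) ⟩
    ⨂ {l = q} (λ _ → #independent) ⊤
      ≡⟨ ⨂-const q #independent ⊤ ⟩
    (#independent ⋆^ q) ⊤ ∎
    where
    open ≡-Reasoning
    colours = enum-Vec (enum-Fin q) n
    classes⁺ : ∀ c → Proper G c → ∀ k → Independent G (colourClass k c)
    classes⁺ c proper k u v u∈k v∈k edge =
      proper u v edge (trans (∈-colourClass⁻ c {k} u∈k) (≡.sym (∈-colourClass⁻ c v∈k)))
    classes⁻ : ∀ c → (∀ k → Independent G (colourClass k c)) → Proper G c
    classes⁻ c independent u v edge same =
      independent (lookup c u) u v (∈-colourClass⁺ c) (subst (λ k → v ∈ colourClass k c) (≡.sym same) (∈-colourClass⁺ c)) edge

  -- The polynomial carried by `exp-derivative` has the chromatic values at all q ≥ 1, and those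
  -- determine it at every integer.
  chromatic≗exp : ∀ {p} → IsChromaticPolynomial G p → ∀ x → eval p x ≡ exp signedRooted x ⊤
  chromatic≗exp {p} chromatic x = trans (eval-unique {p} {poly d} agree x) (eval-poly d x)
    where
    d = exp-derivative signedRooted signedRooted-∅ ⊤
    agree : ∀ q → 1 ℕ.≤ q → eval p (+ q) ≡ eval (poly d) (+ q)
    agree q 1≤q = let m , m-card , eval≡m = chromatic q 1≤q in begin
      eval p (+ q)                      ≡⟨ eval≡m ⟩
      + m                               ≡⟨ #colourings q m-card ⟩
      (#independent ⋆^ q) ⊤             ≡⟨ ⋆^-cong q (exp-1 logarithmic) ⊤ ⟩
      (exp signedRooted 1ℤ ⋆^ q) ⊤      ≡⟨ exp-⋆^ signedRooted 1ℤ q ⊤ ⟨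
      exp signedRooted (+ q * 1ℤ) ⊤     ≡⟨ cong (λ x → exp signedRooted x ⊤) (ℤ.*-identityʳ (+ q)) ⟩
      exp signedRooted (+ q) ⊤          ≡⟨ eval-poly d (+ q) ⟨
      eval (poly d) (+ q)                   ∎
      where open ≡-Reasoning

  BlockOf : ∀ i {l} → BlockProperty n l
  BlockOf i k U M = IsAcyclicOrientation G U M × (toℕ k ℕ.< i → RootedAtMin U M)

  blockOf? : ∀ i {l} k U M → Dec (BlockOf i {l} k U M)
  blockOf? i k U M = isAcyclicOrientation? G U M ×-dec ((toℕ k ℕ.<? i) →-dec rootedAtMin? U M)

  ⨂-split : ∀ i j {f g : SetFunction n} {F : Fin (i ℕ.+ j) → SetFunction n} →
    (∀ k → toℕ k ℕ.< i → F k ≗ f) → (∀ k → ¬ toℕ k ℕ.< i → F k ≗ g) → ⨂ F ≗ (f ⋆^ i) ⋆ (g ⋆^ j)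
  ⨂-split zero    j {f} {g} {F} F≗f F≗g V = trans (⨂-cong {G = λ _ → g} (λ k → F≗g k λ ()) V)
    (trans (⨂-const j g V) (≡.sym (⋆-identityˡ (g ⋆^ j) V)))
  ⨂-split (suc i) j {f} {g} {F} F≗f F≗g V = trans
    (⋆-cong {f = F zero} {f} {⨂ (F ∘ suc)} {(f ⋆^ i) ⋆ (g ⋆^ j)} (F≗f zero (ℕ.s≤s ℕ.z≤n))
      (⨂-split i j (λ k k<i → F≗f (suc k) (ℕ.s≤s k<i)) (λ k k≮i → F≗g (suc k) (k≮i ∘ ℕ.s≤s⁻¹))) V)
    (≡.sym (⋆-assoc f (f ⋆^ i) (g ⋆^ j) V))

  #blocks : ∀ i j → ⨂ (#orientations ∘ blockOf? i {i ℕ.+ j}) ≗ (#rooted ⋆^ i) ⋆ (#acyclic ⋆^ j)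
  #blocks i j = ⨂-split i j
    (λ k k<i U → ∑-cong orients λ M → ⟦⟧-⇔ (blockOf? i k U M) (rootedOrientation? U M)
      (λ (M! , root) → M! , root k<i) (λ (M! , root) → M! , λ _ → root))
    (λ k k≮i U → ∑-cong orients λ M → ⟦⟧-⇔ (blockOf? i k U M) (isAcyclicOrientation? G U M)
      proj₁ (λ M! → M! , λ k<i → contradiction k<i k≮i))

  module _ (i j : ℕ) where
    private
      to : ∀ {t} → Peeled (BlockOf i) ⊤ t → ValidTuple G i j t
      to {t} peeled = disjoint , (λ v → covers v ∈⊤) , proj₁ ∘ good , proj₂ ∘ good
        where open IsPartition (Peeled⇒IsPartition ⊤ t peeled)

      from : ∀ {t} → ValidTuple G i j t → Peeled (BlockOf i) ⊤ t
      from {t} (disjoint , covers , acyclic , rooted) = IsPartition⇒Peeled ⊤ t record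
        { disjoint = disjoint
        ; covers   = λ v _ → covers v
        ; inside   = λ _ _ _ → ∈⊤
        ; good     = λ k → acyclic k , rooted k
        }

    validTuple? : ∀ t → Dec (ValidTuple G i j t)
    validTuple? t = Dec.map′ to from (peeled? (blockOf? i) ⊤ t)

    tuples = enum-Vec (enum-block n) (i ℕ.+ j)

    #tuples : + card tuples validTuple? ≡ ((#rooted ⋆^ i) ⋆ (#acyclic ⋆^ j)) ⊤
    #tuples = trans (+card tuples validTuple?) (trans
      (∑-cong (elements tuples) λ t → ⟦⟧-⇔ (validTuple? t) (peeled? (blockOf? i) ⊤ t) from to)
      (trans (∑-peeled (blockOf? i {i ℕ.+ j}) ⊤) (#blocks i j ⊤)))

  -- The signs (-1)^|block| multiply to (-1)^n, and each of the i factors `signedRooted` contributes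
  -- one further -1.
  signed-product : ∀ i j → ((signedRooted ⋆^ i) ⋆ (signed #acyclic ⋆^ j)) ⊤ ≡
    -1ℤ ^ i * (-1ℤ ^ n * ((#rooted ⋆^ i) ⋆ (#acyclic ⋆^ j)) ⊤)
  signed-product i j = begin
    ((signedRooted ⋆^ i) ⋆ (signed #acyclic ⋆^ j)) ⊤
      ≡⟨ ⋆-cong {f = signedRooted ⋆^ i} {f′ = λ U → -1ℤ ^ i * signed (#rooted ⋆^ i) U} {g = signed #acyclic ⋆^ j}
           (λ U → trans (*-⋆^ -1ℤ (signed #rooted) i U) (cong (-1ℤ ^ i *_) (signed-⋆^ #rooted i U)))
           (signed-⋆^ #acyclic j) ⊤ ⟩
    ((λ U → -1ℤ ^ i * signed (#rooted ⋆^ i) U) ⋆ signed (#acyclic ⋆^ j)) ⊤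
      ≡⟨ *-⋆ (-1ℤ ^ i) (signed (#rooted ⋆^ i)) (signed (#acyclic ⋆^ j)) ⊤ ⟩
    -1ℤ ^ i * (signed (#rooted ⋆^ i) ⋆ signed (#acyclic ⋆^ j)) ⊤
      ≡⟨ cong (-1ℤ ^ i *_) (signed-⋆ (#rooted ⋆^ i) (#acyclic ⋆^ j) ⊤) ⟩
    -1ℤ ^ i * (sgn (⊤ {n}) * ((#rooted ⋆^ i) ⋆ (#acyclic ⋆^ j)) ⊤)
      ≡⟨ cong (λ s → -1ℤ ^ i * (s * ((#rooted ⋆^ i) ⋆ (#acyclic ⋆^ j)) ⊤)) (sgn-⊤ n) ⟩
    -1ℤ ^ i * (-1ℤ ^ n * ((#rooted ⋆^ i) ⋆ (#acyclic ⋆^ j)) ⊤) ∎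
    where open ≡-Reasoning

-- Cancellation of signs and the conclusion

-1^k*-1^k : ∀ k → -1ℤ ^ k * -1ℤ ^ k ≡ 1ℤ
-1^k*-1^k zero    = refl
-1^k*-1^k (suc k) = trans (rearrange (-1ℤ ^ k)) (-1^k*-1^k k)
  where
  rearrange : ∀ a → (-1ℤ * a) * (-1ℤ * a) ≡ a * a
  rearrange = solve-∀

-- For i ≤ n the exponents add up to 2n. For i > n the truncated `n ∸ i` is 0 and the parity may be
-- wrong, so there N has to be zero.
cancel-signs : ∀ n i N → (n ℕ.< i → N ≡ 0ℤ) → -1ℤ ^ (n ∸ i) * (-1ℤ ^ i * (-1ℤ ^ n * N)) ≡ N
cancel-signs n i N N≡0 with i ℕ.≤? n
... | yes i≤n = begin
  -1ℤ ^ (n ∸ i) * (-1ℤ ^ i * (-1ℤ ^ n * N))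
    ≡⟨ reassociate (-1ℤ ^ (n ∸ i)) (-1ℤ ^ i) (-1ℤ ^ n) N ⟩
  -1ℤ ^ (n ∸ i) * -1ℤ ^ i * -1ℤ ^ n * N
    ≡⟨ cong (λ z → z * -1ℤ ^ n * N) (trans (≡.sym (ℤ.^-distribˡ-+-* -1ℤ (n ∸ i) i)) (cong (-1ℤ ^_) (ℕ.m∸n+n≡m i≤n))) ⟩
  -1ℤ ^ n * -1ℤ ^ n * N
    ≡⟨ cong (_* N) (-1^k*-1^k n) ⟩
  1ℤ * N
    ≡⟨ ℤ.*-identityˡ N ⟩
  N ∎
  where
  open ≡-Reasoning
  reassociate : ∀ a b c d → a * (b * (c * d)) ≡ a * b * c * d
  reassociate = solve-∀
... | no i≰n rewrite N≡0 (ℕ.≰⇒> i≰n) = vanish (-1ℤ ^ (n ∸ i)) (-1ℤ ^ i) (-1ℤ ^ n)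
  where
  vanish : ∀ a b c → a * (b * (c * 0ℤ)) ≡ 0ℤ
  vanish = solve-∀

theorem1p1 : (n : ℕ) (G : Graph n) (p : Poly) → IsChromaticPolynomial G p →
    (i j : ℕ) →
    Σ ℕ λ m → HasCard (Tuples G i j) m ×
    ((- (+ 1)) ^ (n ∸ i)) * eval (derivⁱ i p) (- (+ j)) ≡ + m
theorem1p1 n G p chromatic i j = card (tuples i j) (validTuple? i j) , card-↔ (tuples i j) (validTuple? i j) , (begin
  -1ℤ ^ (n ∸ i) * eval (derivⁱ i p) (- (+ j))
    ≡⟨ cong (-1ℤ ^ (n ∸ i) *_) (eval-derivⁱ-exp signedRooted signedRooted-∅ ⊤ p (chromatic≗exp {p} chromatic) i (- (+ j))) ⟩
  -1ℤ ^ (n ∸ i) * ((signedRooted ⋆^ i) ⋆ exp signedRooted (- (+ j))) ⊤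
    ≡⟨ cong (-1ℤ ^ (n ∸ i) *_) (⋆-congˡ (signedRooted ⋆^ i) {g′ = signed #acyclic ⋆^ j} exp-−j ⊤) ⟩
  -1ℤ ^ (n ∸ i) * ((signedRooted ⋆^ i) ⋆ (signed #acyclic ⋆^ j)) ⊤
    ≡⟨ cong (-1ℤ ^ (n ∸ i) *_) (signed-product i j) ⟩
  -1ℤ ^ (n ∸ i) * (-1ℤ ^ i * (-1ℤ ^ n * N))
    -- For i > n there are fewer vertices than blocks that must be nonempty.
    ≡⟨ cancel-signs n i N (λ n<i → ⋆^-order #rooted (#acyclic ⋆^ j) #rooted-∅ i ⊤
         (subst (ℕ._< i) (≡.sym (∣⊤∣≡n n)) n<i)) ⟩
  N
    ≡⟨ #tuples i j ⟨
  + card (tuples i j) (validTuple? i j) ∎)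
  where
  open ≡-Reasoning
  open Counts G
  N = ((#rooted ⋆^ i) ⋆ (#acyclic ⋆^ j)) ⊤
  exp-−j : exp signedRooted (- (+ j)) ≗ signed #acyclic ⋆^ j
  -- -j is rewritten as j · (-1), so that exp(-jL) becomes the j-th power of exp(-L).
  exp-−j V = trans (cong (λ x → exp signedRooted x V) (trans (≡.sym (ℤ.-1*i≡-i (+ j))) (ℤ.*-comm -1ℤ (+ j))))
    (trans (exp-⋆^ signedRooted -1ℤ j V) (⋆^-cong j (λ U → ≡.sym (exp-−1 logarithmic U)) V))
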